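{- For every $\Delta\geq 2$, $\Delta$-TVC can be solved in time $\mathcal{O}((2\Delta)^k\,T\,n^2)$, where $k$ is the cardinality of a minimum $\Delta$-TVC, $n$ is the number of vertices of the underlying graph and $T$ the lifetime. In particular, $\Delta$-TVC is fixed-parameter tractable parameterized by $k$.
   Context: A temporal graph is a pair $(G,\lambda)$ where $G=(V,E)$ is a finite static graph and $\lambda: E \to 2^{\mathbb{N}}$ assigns to every edge a finite set of positive integer time labels; $e$ is active at time $t$ if $t \in \lambda(e)$. The lifetime is $T=\max\{t : t\in\lambda(e), e\in E\}$. For $\Delta\in\mathbb{N}$ and $t \in [1, T-\Delta+1]$, the $\Delta$-time window is $W_t=[t,t+\Delta-1]$. A vertex appearance is a pair $(v,t)$ with $v\in V$, $t\in[T]$. For a set $S$ of vertex appearances, $S[W_i]=\{(v,t)\in S : t\in W_i\}$, and $E[W_i]=\{e\in E : \lambda(e)\cap W_i\neq\emptyset\}$. A set $S$ of vertex appearances is a sliding $\Delta$-time window temporal vertex cover ($\Delta$-TVC) of $(G,\lambda)$ if for every $i\in[1,T-\Delta+1]$ and every $e\in E[W_i]$ there is $(v,t)\in S[W_i]$ with $v$ an endpoint of $e$ and $t\in\lambda(e)$. The $\Delta$-TVC problem asks for a $\Delta$-TVC of minimum cardinality. -}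

module Defs where

open import Data.Bool.Base using (Bool; true; false; if_then_else_)
open import Data.Fin.Base using (Fin; toℕ)
open import Data.List.Base using (List; []; _∷_; length; map; concatMap; allFin; applyUpTo)
open import Data.List.Extrema.Nat using (max)
open import Data.List.Membership.Propositional using (_∈_)
open import Data.List.Relation.Unary.All using (All)
open import Data.List.Relation.Unary.Unique.Propositional using (Unique)
open import Data.Nat.Base using (ℕ; zero; suc; _+_; _*_; _∸_; _^_; _≤_; _<_)
open import Data.Nat.Properties using (_≟_)
open import Data.List.Membership.DecPropositional _≟_ using (_∈?_)
open import Data.Product.Base using (_×_; _,_; ∃-syntax)
open import Data.Sum.Base using (_⊎_)
open import Relation.Binary.PropositionalEquality.Core using (_≡_; _≢_)
open import Relation.Nullary.Decidable.Core using (does)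

------------------------------------------------------------------------
-- Temporal graphs

-- The vertex set is Fin n.  `labels u v` enumerates the set λ({u,v}); it is
-- used only through membership, so repetitions are harmless.  λ is extended
-- by ∅ to non-edges; an edge may also have no label.
record TemporalGraph : Set where
  field
    n             : ℕ
    adj           : Fin n → Fin n → Bool
    adj-sym       : ∀ u v → adj u v ≡ adj v u
    adj-irrefl    : ∀ v → adj v v ≡ false
    labels        : Fin n → Fin n → List ℕ
    labels-sym    : ∀ u v → labels u v ≡ labels v u
    labels-edge   : ∀ u v t → t ∈ labels u v → adj u v ≡ true
    labels-pos    : ∀ u v t → t ∈ labels u v → 1 ≤ t

  -- The maximum of the empty set of labels is taken to be 0.
  lifetime : ℕ
  lifetime = max 0 (concatMap (λ u → concatMap (labels u) (allFin n)) (allFin n))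

  VertexAppearance : Set
  VertexAppearance = Fin n × ℕ

  IsVertexAppearance : VertexAppearance → Set
  IsVertexAppearance (_ , t) = 1 ≤ t × t ≤ lifetime

open TemporalGraph public

------------------------------------------------------------------------
-- Sliding Δ-time window temporal vertex covers

module _ (Δ : ℕ) where

  _∈W_ : ℕ → ℕ → Set
  t ∈W i = i ≤ t × t ≤ i + Δ ∸ 1

  -- i ∈ [1 , T - Δ + 1], an empty range when T < Δ; the inequality is
  -- rearranged because subtraction on ℕ is truncated.
  IsWindow : TemporalGraph → ℕ → Set
  IsWindow G i = 1 ≤ i × i + Δ ≤ lifetime G + 1

  -- {u,v} ∈ E[W i]
  InE[W] : (G : TemporalGraph) → ℕ → Fin (n G) → Fin (n G) → Set
  InE[W] G i u v = adj G u v ≡ true × ∃[ t ] (t ∈ labels G u v × t ∈W i)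

  -- A set of vertex appearances is a repetition-free list, so its
  -- cardinality is its length.
  record IsTVC (G : TemporalGraph) (S : List (VertexAppearance G)) : Set where
    field
      unique : Unique S
      valid  : All (IsVertexAppearance G) S
      covers : ∀ i → IsWindow G i → ∀ u v → InE[W] G i u v →
               ∃[ w ] ∃[ t ] ((w , t) ∈ S × t ∈W i ×
                              (w ≡ u ⊎ w ≡ v) × t ∈ labels G u v)

  record IsMinimumTVC (G : TemporalGraph) (S : List (VertexAppearance G)) : Set where
    field
      isTVC   : IsTVC G S
      minimum : ∀ S′ → IsTVC G S′ → length S ≤ length S′

------------------------------------------------------------------------
-- Machine model: structured programs for a unit-cost random access machine
-- whose only arithmetic is addition and truncated subtraction.  (Unit-cost
-- multiplication would allow numbers whose length is exponential in the
-- running time.)  The memory is divided into arrays of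
-- naturals.  Array names are literals, so a program uses only finitely many
-- of them, and interleaving these simulates it on a single memory with a
-- constant-factor overhead.  A scalar variable is an array used at index 0.

infix  22 _⟨_⟩
infixl 21 _⊕_ _⊖_

data Exp : Set where
  lit     : ℕ → Exp
  _⟨_⟩    : ℕ → Exp → Exp
  _⊕_ _⊖_ : Exp → Exp → Exp

infix  20 _⟨_⟩≔_
infixr 19 _⨾_

data Program : Set where
  skip    : Program
  _⟨_⟩≔_  : ℕ → Exp → Exp → Program
  _⨾_     : Program → Program → Program
  if≢0    : Exp → Program → Program → Program
  while≢0 : Exp → Program → Program

State : Set
State = ℕ → ℕ → ℕ

eval : Exp → State → ℕ
eval (lit k)   s = k
eval (a ⟨ e ⟩) s = s a (eval e s)
eval (d ⊕ e)   s = eval d s + eval e s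
eval (d ⊖ e)   s = eval d s ∸ eval e s

cost : Exp → ℕ
cost (lit k)   = 1
cost (a ⟨ e ⟩) = 1 + cost e
cost (d ⊕ e)   = 1 + cost d + cost e
cost (d ⊖ e)   = 1 + cost d + cost e

store : ℕ → ℕ → ℕ → State → State
store a i x s b j =
  if does (b ≟ a) then (if does (j ≟ i) then x else s b j) else s b j

-- P , s ⇓ s′ steps t : started in state s, P halts in state s′ after time t.
infix 4 _,_⇓_steps_

data _,_⇓_steps_ : Program → State → State → ℕ → Set where
  ⇓skip : ∀ {s} → skip , s ⇓ s steps 1
  ⇓set  : ∀ {s a d e} →
          a ⟨ d ⟩≔ e , s ⇓ store a (eval d s) (eval e s) s steps (1 + cost d + cost e)
  ⇓seq  : ∀ {P Q s s′ s″ t u} →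
          P , s ⇓ s′ steps t → Q , s′ ⇓ s″ steps u → P ⨾ Q , s ⇓ s″ steps (t + u)
  ⇓then : ∀ {e P Q s s′ t} → eval e s ≢ 0 →
          P , s ⇓ s′ steps t → if≢0 e P Q , s ⇓ s′ steps (1 + cost e + t)
  ⇓else : ∀ {e P Q s s′ t} → eval e s ≡ 0 →
          Q , s ⇓ s′ steps t → if≢0 e P Q , s ⇓ s′ steps (1 + cost e + t)
  ⇓loop : ∀ {e P s s′ s″ t u} → eval e s ≢ 0 →
          P , s ⇓ s′ steps t → while≢0 e P , s′ ⇓ s″ steps u →
          while≢0 e P , s ⇓ s″ steps (1 + cost e + t + u)
  ⇓exit : ∀ {e P s} → eval e s ≡ 0 → while≢0 e P , s ⇓ s steps (1 + cost e)

-- List indexing with default value 0.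
nth : List ℕ → ℕ → ℕ
nth []       i       = 0
nth (x ∷ xs) zero    = x
nth (x ∷ xs) (suc i) = nth xs i

-- The input is placed in array 0; all remaining cells are 0.
initial : List ℕ → State
initial xs zero    = nth xs
initial xs (suc a) = λ _ → 0

-- The output is read from array 1: its length in cell 0, followed by its entries.
IsOutput : State → List ℕ → Set
IsOutput s ys = s 1 0 ≡ length ys × (∀ i → i < length ys → s 1 (suc i) ≡ nth ys i)

Outputs : Program → List ℕ → List ℕ → ℕ → Set
Outputs P xs ys t = ∃[ s ] (P , initial xs ⇓ s steps t × IsOutput s ys)

Computable : (ℕ → ℕ) → Set
Computable f = ∃[ P ] (∀ k → ∃[ t ] Outputs P (k ∷ []) (f k ∷ []) t)

------------------------------------------------------------------------
-- Parameterized problems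

record ParameterizedProblem : Set₁ where
  field
    Instance    : Set
    encode      : Instance → List ℕ
    IsSolution  : Instance → List ℕ → Set
    IsParameter : Instance → ℕ → Set

  size : Instance → ℕ
  size x = length (encode x)

open ParameterizedProblem public

-- P halts on every instance with a correct output, within a time bound that
-- may refer to the parameter value k.
_Solves_InTime_ : Program → (Π : ParameterizedProblem) → (Instance Π → ℕ → ℕ) → Set
P Solves Π InTime bound =
  ∀ x → ∃[ ys ] ∃[ t ] (Outputs P (encode Π x) ys t × IsSolution Π x ys ×
                        (∀ k → IsParameter Π x k → t ≤ bound x k))

FixedParameterTractable : ParameterizedProblem → Set
FixedParameterTractable Π =
  ∃[ P ] ∃[ f ] ∃[ c ] (Computable f × (P Solves Π InTime λ x k → f k * size Π x ^ c))

------------------------------------------------------------------------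
-- The problem Δ-TVC, parameterized by the cardinality of a minimum solution

bit : Bool → ℕ
bit b = if b then 1 else 0

-- Δ, n and T, followed by one block of T + 1 bits for each ordered pair of
-- vertices (u , v), in lexicographic order: whether {u,v} is an edge, and for
-- t = 1, …, T whether t ∈ λ({u,v}).  The size of an instance is thus
-- 3 + n² (T + 1).
encodeTVC : ℕ → TemporalGraph → List ℕ
encodeTVC Δ G = Δ ∷ n G ∷ lifetime G ∷
  concatMap (λ u → concatMap (block u) (allFin (n G))) (allFin (n G))
  where
  block : Fin (n G) → Fin (n G) → List ℕ
  block u v = bit (adj G u v) ∷
    map (λ t → bit (does (t ∈? labels G u v))) (applyUpTo suc (lifetime G))

encodeAppearances : (G : TemporalGraph) → List (VertexAppearance G) → List ℕ
encodeAppearances G = concatMap λ (v , t) → toℕ v ∷ t ∷ []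

TVC : ℕ → ParameterizedProblem
TVC Δ = record
  { Instance    = TemporalGraph
  ; encode      = encodeTVC Δ
  ; IsSolution  = λ G ys → ∃[ S ] (IsMinimumTVC Δ G S × ys ≡ encodeAppearances G S)
  ; IsParameter = λ G k → ∃[ S ] (IsMinimumTVC Δ G S × k ≡ length S)
  }

{-# OPTIONS --safe #-}

-- The algorithm is a breadth-first search.  A node of the search tree is a set of
-- marked appearances; a node that leaves an edge uv without a marked label in some
-- window where it has a label branches over the 2Δ appearances of u and of v in
-- that window.  Any cover S contains an unmarked one of these, so some child
-- brings the marks one step closer to containing S, and a node without uncovered
-- windows is met on level |S| at the latest.  Since the levels are met in order and
-- a node on level d has at most d marks, the first such node is a minimum cover,
-- and at most 1 + 2Δ + ... + (2Δ)^k ≤ 2 (2Δ)^k nodes are visited.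
--
-- The tree is complete, so the parent of each node is found by counting to 2Δ, and
-- every node stores its marks in a block of memory of its own, copied from its
-- parent.  One pass over the input finds an uncovered window: for each pair of
-- vertices it suffices to remember the last label and the last marked label.
module Submission where

open import Data.Bool.Base using (Bool; true; false; _∧_; not; if_then_else_)
open import Data.Bool.Properties using (∧-conicalˡ; ∧-conicalʳ)
open import Data.Fin.Base using (Fin; zero; suc; toℕ; fromℕ<)
open import Data.Fin.Properties using (toℕ-fromℕ<; toℕ-injective; toℕ<n)
open import Data.List.Base using (List; []; _∷_; [_]; _++_; length; concatMap; map; tabulate; allFin;
  applyUpTo; upTo)
open import Data.List.Extrema.Nat using (max; xs≤max)
open import Data.List.Membership.Propositional using (_∈_; lose)
open import Data.List.Membership.Propositional.Properties
  using (∈-++⁻; ∈-++⁺ˡ; ∈-++⁺ʳ; ∈-map⁺; ∈-map⁻; ∈-allFin; ∈-concatMap⁺; ∈-upTo⁺)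
open import Data.List.Properties
  using (length-++; length-map; length-applyUpTo; length-removeAt′; concatMap-++)
open import Data.List.Relation.Binary.Subset.Propositional using (_⊆_)
open import Data.List.Relation.Unary.All as All using ([]; _∷_)
import Data.List.Relation.Unary.All.Properties as All
open import Data.List.Relation.Unary.AllPairs using ([]; _∷_)
open import Data.List.Relation.Unary.Any using (here; there; index; _─_)
open import Data.List.Relation.Unary.Unique.Propositional using (Unique)
import Data.List.Relation.Unary.Unique.Propositional.Properties as Unique
open import Data.Nat.Base
open import Data.Nat.DivMod using (_/_; _%_; m≡m%n+[m/n]*n; m%n<n; [m+kn]%n≡m%n; m<n⇒m%n≡m)
open import Data.Nat.Properties
open import Data.List.Membership.DecPropositional _≟_ using (_∈?_)
open import Data.Nat.Tactic.RingSolver using (solve-∀)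
open import Data.Product.Base using (_×_; _,_; ∃-syntax; Σ-syntax; proj₁; proj₂)
open import Data.Sum.Base as Sum using (_⊎_; inj₁; inj₂)
open import Relation.Binary.Definitions using (tri<; tri≈; tri>)
open import Relation.Binary.PropositionalEquality hiding ([_])
open import Relation.Nullary using (¬_; Dec; does; yes; no; contradiction)
open import Relation.Nullary.Decidable using (dec-true; dec-false)
open import Defs

-- Reasoning about programs

-- Neither k nor any cover is known to the program, so no depth limit can be prescribed; a search by
-- increasing levels needs none. The time bound uses only that the j nodes before the final one are
-- open: this gives `j ≤ last (length S)` for every cover S at once, so a minimum cover is never
-- singled out. That the search halts has to be settled beforehand, and there the set of all cells
-- plays the part of S; this is why the bound for halting is kept apart from the number of rounds
-- that is charged.
--
-- One program and one constant must serve all Δ. Hence Δ is read from the input, the branching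
-- degree included, and running times have the form `coeff P * Y` with `coeff P` depending on the
-- program text alone. Since the machine only adds and subtracts, addresses such as j * n * (T + 1)
-- are kept up to date by additions, and quotients and remainders by 2Δ appear only in proofs.
--
-- The maximum with 1 in the time bound covers graphs without labels, for which the product is 0
-- while the program still takes a few steps.

override-≡ : ∀ {i j x y : ℕ} → j ≡ i → (if does (j ≟ i) then x else y) ≡ x
override-≡ {i} {j} {x} {y} j≡i = cong (if_then x else y) (dec-true (j ≟ i) j≡i)

override-≢ : ∀ {i j x y : ℕ} → j ≢ i → (if does (j ≟ i) then x else y) ≡ y
override-≢ {i} {j} {x} {y} j≢i = cong (if_then x else y) (dec-false (j ≟ i) j≢i)

-- Boolean, so that for a concrete program `refl` proves that an array is preserved; loop invariants
-- then mention only what the body changes.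
keeps : ℕ → Program → Bool
keeps a skip          = true
keeps a (b ⟨ _ ⟩≔ _)  = not (does (a ≟ b))
keeps a (P ⨾ Q)       = keeps a P ∧ keeps a Q
keeps a (if≢0 _ P Q)  = keeps a P ∧ keeps a Q
keeps a (while≢0 _ P) = keeps a P

record Frame (P : Program) (s s′ : State) : Set where
  field at : ∀ a → keeps a P ≡ true → ∀ i → s′ a i ≡ s a i
open Frame public

frame : ∀ {P s s′ t} → P , s ⇓ s′ steps t → Frame P s s′
frame {P} D .at a k i = go D k
  where
  go : ∀ {P s s′ t} → P , s ⇓ s′ steps t → keeps a P ≡ true → s′ a i ≡ s a i
  go ⇓skip k = refl
  go (⇓set {a = b}) k with a ≡ᵇ b
  ... | false = refl
  ... | true with () ← k
  go (⇓seq {P} {Q} D E) k =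
    trans (go E (∧-conicalʳ (keeps a P) _ k)) (go D (∧-conicalˡ (keeps a P) _ k))
  go (⇓then {P = P} _ D) k = go D (∧-conicalˡ (keeps a P) _ k)
  go (⇓else {P = P} _ D) k = go D (∧-conicalʳ (keeps a P) _ k)
  go (⇓loop _ D E) k = trans (go E k) (go D k)
  go (⇓exit _) k = refl

Frame-trans : ∀ {P s s′ s″} → Frame P s s′ → Frame P s′ s″ → Frame P s s″
Frame-trans f g .at a k i = trans (g .at a k i) (f .at a k i)

coeff : Program → ℕ
coeff skip          = 1
coeff (_ ⟨ d ⟩≔ e)  = 1 + cost d + cost e
coeff (P ⨾ Q)       = coeff P + coeff Q
coeff (if≢0 e P Q)  = 1 + cost e + (coeff P + coeff Q)
-- One summand `1 + cost e` pays for the test that opens each round, the other for the final failing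
-- test.
coeff (while≢0 e P) = coeff P + 2 * (1 + cost e)

-- The running time is measured in multiples of a unit Y ≥ 1; a loop multiplies
-- the unit by its number of rounds, so that coeff P never depends on the input.
record Run (P : Program) (s : State) (Y : ℕ) (Q : State → Set) : Set where
  constructor run
  field
    {final} : State
    {time}  : ℕ
    exec    : P , s ⇓ final steps time
    bounded : time ≤ coeff P * Y
    result  : Q final

map-run : ∀ {P s Y} {Q R : State → Set} → (∀ s′ → Frame P s s′ → Q s′ → R s′) →
          Run P s Y Q → Run P s Y R
map-run f (run D b q) = run D b (f _ (frame D) q)

enlarge : ∀ {P s Y Z Q} → Y ≤ Z → Run P s Y Q → Run P s Z Q
enlarge {P} Y≤Z (run D b q) = run D (≤-trans b (*-monoʳ-≤ (coeff P) Y≤Z)) q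

skip-run : ∀ {s Y Q} .{{_ : NonZero Y}} → Q s → Run skip s Y Q
skip-run {Y = Y} q = run ⇓skip (m≤m*n 1 Y) q

set-run : ∀ {a d e s Y Q} .{{_ : NonZero Y}} →
          Q (store a (eval d s) (eval e s) s) → Run (a ⟨ d ⟩≔ e) s Y Q
set-run {d = d} {e} {Y = Y} q = run ⇓set (m≤m*n (1 + cost d + cost e) Y) q

seq-run : ∀ {P Q s Y R S} → Run P s Y R → (∀ s′ → Frame P s s′ → R s′ → Run Q s′ Y S) →
          Run (P ⨾ Q) s Y S
seq-run {P} {Q} {Y = Y} (run D b r) next with next _ (frame D) r
... | run E c q = run (⇓seq D E)
  (≤-trans (+-mono-≤ b c) (≤-reflexive (sym (*-distribʳ-+ Y (coeff P) (coeff Q))))) q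

set-then : ∀ {a d e P s Y Q} .{{_ : NonZero Y}} →
           Run P (store a (eval d s) (eval e s) s) Y Q → Run ((a ⟨ d ⟩≔ e) ⨾ P) s Y Q
set-then {a} {d} {e} {s = s} r =
  seq-run (set-run {Q = _≡ store a (eval d s) (eval e s) s} refl) λ where _ _ refl → r

private
  branch-bound : ∀ c k l Y t .{{_ : NonZero Y}} → t ≤ k * Y → 1 + c + t ≤ (1 + c + (k + l)) * Y
  branch-bound c k l Y t t≤kY = begin
    1 + c + t                ≤⟨ +-mono-≤ (m≤m*n (1 + c) Y) t≤kY ⟩
    (1 + c) * Y + k * Y      ≡⟨ sym (*-distribʳ-+ Y (1 + c) k) ⟩
    (1 + c + k) * Y          ≤⟨ *-monoˡ-≤ Y (+-monoʳ-≤ (1 + c) (m≤m+n k l)) ⟩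
    (1 + c + (k + l)) * Y    ∎
    where open ≤-Reasoning

if-run : ∀ {e P P′ s Y Q} .{{_ : NonZero Y}} →
         (eval e s ≢ 0 → Run P s Y Q) → (eval e s ≡ 0 → Run P′ s Y Q) →
         Run (if≢0 e P P′) s Y Q
if-run {e} {P} {P′} {s} {Y} f g with eval e s ≟ 0
... | no ≢0 with f ≢0
...   | run {time = t} D b q =
  run (⇓then ≢0 D) (branch-bound (cost e) (coeff P) (coeff P′) Y t b) q
if-run {e} {P} {P′} {s} {Y} f g | yes ≡0 with g ≡0
...   | run {time = t} D b q = run (⇓else ≡0 D)
  (subst (λ k → 1 + cost e + t ≤ (1 + cost e + k) * Y) (+-comm (coeff P′) (coeff P))
         (branch-bound (cost e) (coeff P′) (coeff P) Y t b)) q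

-- Loops

record Iterated (e : Exp) (P : Program) (s : State) (Y : ℕ) (Q : ℕ → State → Set) : Set where
  constructor iterated
  field
    {final}  : State
    {time}   : ℕ
    rounds   : ℕ
    exec     : while≢0 e P , s ⇓ final steps time
    bounded  : time ≤ rounds * (1 + cost e + coeff P * Y) + (1 + cost e)
    result   : Q rounds final
    finished : eval e final ≡ 0

-- N only ensures termination: every round has to show that its number is below N. The time refers
-- to the rounds actually performed, which may be far fewer.
iterate : ∀ {e P Y} (I : ℕ → State → Set) N →
          (∀ j s → I j s → eval e s ≢ 0 → j < N × Run P s Y (I (suc j))) →
          ∀ {s} → I 0 s → Iterated e P s Y I
iterate {e} {P} {Y} I N step {s} i₀ with eval e s ≟ 0
... | yes ≡0 = iterated 0 (⇓exit ≡0) ≤-refl i₀ ≡0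
iterate I zero step {s} i₀ | no ≢0 with () ← proj₁ (step 0 s i₀ ≢0)
iterate {e} {P} {Y} I (suc N) step {s} i₀ | no ≢0 with proj₂ (step 0 s i₀ ≢0)
... | run {time = t} D b i₁
  with iterate (λ j → I (suc j)) N
         (λ j s i ≢0 → let (l , r) = step (suc j) s i ≢0 in s≤s⁻¹ l , r) i₁
... | iterated {time = u} j E c iⱼ ≡0 = iterated (suc j) (⇓loop ≢0 D E) bound iⱼ ≡0
  where
  open ≤-Reasoning
  w = 1 + cost e
  bound : w + t + u ≤ suc j * (w + coeff P * Y) + w
  bound = begin
    w + t + u                                        ≤⟨ +-mono-≤ (+-monoʳ-≤ w b) c ⟩
    w + coeff P * Y + (j * (w + coeff P * Y) + w)    ≡⟨ sym (+-assoc (w + coeff P * Y) _ w) ⟩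
    suc j * (w + coeff P * Y) + w                    ∎

private
  rounds-bound : ∀ N j w k Y .{{_ : NonZero N}} .{{_ : NonZero Y}} → j ≤ N →
                 j * (w + k * Y) + w ≤ (k + 2 * w) * (N * Y)
  rounds-bound N j w k Y j≤N = begin
    j * (w + k * Y) + w                ≤⟨ +-monoˡ-≤ w (*-monoˡ-≤ (w + k * Y) j≤N) ⟩
    N * (w + k * Y) + w                ≤⟨ +-mono-≤ (*-monoʳ-≤ N (+-monoˡ-≤ (k * Y) (m≤m*n w Y)))
                                            (m≤m*n w (N * Y)) ⟩
    N * (w * Y + k * Y) + w * (N * Y)  ≡⟨ identity N w k Y ⟩
    (k + 2 * w) * (N * Y)              ∎
    where
    open ≤-Reasoning
    instance _ = m*n≢0 N Y
    identity : ∀ N w k Y → N * (w * Y + k * Y) + w * (N * Y) ≡ (k + 2 * w) * (N * Y)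
    identity = solve-∀

-- Charging one round more than performed keeps the unit positive when the loop is left at once, so
-- that the failing test can still be paid.
until-run : ∀ {e P s Y Q} .{{_ : NonZero Y}} → (r : Iterated e P s Y Q) →
            Run (while≢0 e P) s (suc (Iterated.rounds r) * Y)
                (λ s′ → Q (Iterated.rounds r) s′ × eval e s′ ≡ 0)
until-run {e} {P} {Y = Y} (iterated j D b q ≡0) =
  run D (≤-trans b (rounds-bound (suc j) j (1 + cost e) (coeff P) Y (n≤1+n j))) (q , ≡0)

infix 20 _≔_
_≔_ : ℕ → Exp → Program
a ≔ e = a ⟨ lit 0 ⟩≔ e

var : ℕ → Exp
var a = a ⟨ lit 0 ⟩

weaken : ∀ {P Q s s′} → (∀ a → keeps a Q ≡ true → keeps a P ≡ true) → Frame P s s′ → Frame Q s s′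
weaken f fr .at a k = fr .at a (f a k)

for : ℕ → Exp → Program → Program
for i e P = i ≔ lit 0 ⨾ while≢0 (e ⊖ var i) (P ⨾ i ≔ lit 1 ⊕ var i)

-- The body must establish the invariant at the state with the counter already advanced. For an
-- invariant about other arrays this `store` disappears by computation, so the increment causes no
-- proof obligation.
for-run : ∀ {i e P Y s} N (I : ℕ → State → Set) .{{_ : NonZero N}} .{{_ : NonZero Y}} →
  keeps i P ≡ true →
  (∀ s′ → Frame (for i e P) s s′ → eval e s′ ≡ N) →
  I 0 (store i 0 0 s) →
  (∀ m s′ → m < N → s′ i 0 ≡ m → Frame (for i e P) s s′ → I m s′ →
     Run P s′ Y (λ s″ → I (suc m) (store i 0 (suc m) s″))) →
  Run (for i e P) s (N * Y) (I N)
for-run {i} {e} {P} {Y} {s} N I keep bound i₀ step =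
  seq-run (set-run {Q = Inv 0} {{m*n≢0 N Y}} start) λ s₀ _ j₀ → finish (iterate Inv N round j₀)
  where
  Inv : ℕ → State → Set
  Inv m s′ = m ≤ N × s′ i 0 ≡ m × Frame (for i e P) s s′ × I m s′

  counter : Program
  counter = i ≔ lit 1 ⊕ var i

  kept-outside : ∀ a → keeps a (for i e P) ≡ true → keeps a (i ≔ lit 0) ≡ true
  kept-outside a = ∧-conicalˡ _ _

  kept-inside : ∀ a → keeps a (for i e P) ≡ true → keeps a (P ⨾ counter) ≡ true
  kept-inside a = ∧-conicalʳ (keeps a (i ≔ lit 0)) _

  start : Inv 0 (store i 0 0 s)
  start = z≤n , override-≡ {i} {i} refl , weaken kept-outside (frame (⇓set {s} {i} {lit 0} {lit 0})) , i₀

  round : ∀ m s′ → Inv m s′ → eval (e ⊖ var i) s′ ≢ 0 →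
          m < N × Run (P ⨾ counter) s′ Y (Inv (suc m))
  round m s′ (m≤N , refl , fr , im) ≢0 =
    m<N , map-run extend (seq-run (step m s′ m<N refl fr im)
      λ s″ fr′ im′ → set-run {Q = λ s‴ → s‴ i 0 ≡ suc m × I (suc m) s‴}
        (subst (λ x → store i 0 (suc x) s″ i 0 ≡ suc m × I (suc m) (store i 0 (suc x) s″))
               (sym (fr′ .at i keep 0)) (override-≡ {i} {i} refl , im′)))
    where
    m<N : m < N
    m<N = ≰⇒> λ N≤m → ≢0 (m≤n⇒m∸n≡0 (subst (_≤ m) (sym (bound s′ fr)) N≤m))
    extend : ∀ s″ → Frame (P ⨾ counter) s′ s″ → s″ i 0 ≡ suc m × I (suc m) s″ → Inv (suc m) s″
    extend s″ fr′ (eq , im′) = m<N , eq , Frame-trans fr (weaken kept-inside fr′) , im′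

  finish : ∀ {s₀} → Iterated (e ⊖ var i) (P ⨾ counter) s₀ Y Inv →
           Run (while≢0 (e ⊖ var i) (P ⨾ counter)) s₀ (N * Y) (I N)
  finish (iterated j D b (j≤N , eq , fr , ij) ≡0) =
    run D (≤-trans b (rounds-bound N j (1 + cost (e ⊖ var i)) (coeff (P ⨾ counter)) Y j≤N))
        (subst (λ m → I m _) (≤-antisym j≤N N≤j) ij)
    where
    N≤j : N ≤ j
    N≤j = subst₂ _≤_ (bound _ fr) eq (m∸n≡0⇒m≤n ≡0)

-- The search tree

∈-─ : ∀ {A : Set} {x y : A} {xs} (x∈xs : x ∈ xs) → y ∈ xs → y ≢ x → y ∈ (xs ─ x∈xs)
∈-─ (here refl) (here refl) y≢x = contradiction refl y≢x
∈-─ (here refl) (there q)   y≢x = q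
∈-─ (there p)   (here refl) y≢x = here refl
∈-─ (there p)   (there q)   y≢x = there (∈-─ p q y≢x)

Unique-⊆⇒length≤ : ∀ {A : Set} {xs ys : List A} → Unique xs → xs ⊆ ys → length xs ≤ length ys
Unique-⊆⇒length≤ {xs = []} _ _ = z≤n
Unique-⊆⇒length≤ {xs = x ∷ xs} {ys} (x∉xs ∷ xs!) xs⊆ys = begin
  suc (length xs)          ≤⟨ s≤s (Unique-⊆⇒length≤ xs! λ y∈xs →
                                ∈-─ x∈ys (xs⊆ys (there y∈xs)) (≢-sym (All.lookup x∉xs y∈xs))) ⟩
  suc (length (ys ─ x∈ys)) ≡⟨ sym (length-removeAt′ ys (index x∈ys)) ⟩
  length ys                ∎
  where
  open ≤-Reasoning
  x∈ys = xs⊆ys (here refl)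

-- A is the input array; its first three cells hold Δ, n and T.
module Search (A : ℕ → ℕ) where

  Δ ν T W B : ℕ
  Δ = A 0
  ν = A 1
  T = A 2
  W = suc T
  B = 2 * Δ

  -- A block of W cells opens with the edge bit, so the bit of label t sits at offset t exactly.
  -- Time 0 would read the edge bit, but windows start at 1.
  Active : ℕ → ℕ → ℕ → Set
  Active u v t = A (3 + ((u * ν + v) * W + t)) ≢ 0

  -- Rows of marks have the same length W as the blocks of the input, so that a single stride
  -- advances both.
  cell : ℕ → ℕ → ℕ
  cell u t = u * W + t

  cell-bound : ∀ {u t} → u < ν → t < W → cell u t < ν * W
  cell-bound {u} {t} u<ν t<W = begin-strict
    u * W + t   <⟨ +-monoʳ-< (u * W) t<W ⟩
    u * W + W   ≡⟨ +-comm (u * W) W ⟩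
    suc u * W   ≤⟨ *-monoˡ-≤ W u<ν ⟩
    ν * W       ∎
    where open ≤-Reasoning

  InWindow : ℕ → ℕ → Set
  InWindow i t = i ≤ t × t < i + Δ

  InWindow⇒<W : ∀ {i t} → i + Δ ≤ W → InWindow i t → t < W
  InWindow⇒<W i+Δ≤W (_ , t<i+Δ) = ≤-trans t<i+Δ i+Δ≤W

  hits : (ℕ → ℕ) → ℕ → ℕ → ℕ → ℕ
  hits M u v t = M (cell u t) + M (cell v t)

  CoveredIn : (ℕ → ℕ) → ℕ → ℕ → ℕ → Set
  CoveredIn M u v i = ∀ t → InWindow i t → Active u v t →
                      ∃[ t′ ] (InWindow i t′ × Active u v t′ × hits M u v t′ ≢ 0)

  CoveredPair : (ℕ → ℕ) → ℕ → ℕ → Set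
  CoveredPair M u v = ∀ i → 1 ≤ i → i + Δ ≤ W → CoveredIn M u v i

  Covered : (ℕ → ℕ) → Set
  Covered M = ∀ u → u < ν → ∀ v → v < ν → CoveredPair M u v

  -- Indexed by the addresses of the first cell of the window in the two rows, the only trace of
  -- `u`, `v` and `i` that a node keeps in memory.
  record Uncovered (M : ℕ → ℕ) (startU startV : ℕ) : Set where
    constructor uncovered
    field
      {u v i} : ℕ
      u<ν     : u < ν
      v<ν     : v < ν
      1≤i     : 1 ≤ i
      i+Δ≤W   : i + Δ ≤ W
      startU≡ : startU ≡ cell u i
      startV≡ : startV ≡ cell v i
      occurs  : ∃[ t ] (InWindow i t × Active u v t)
      unhit   : ∀ t → InWindow i t → Active u v t → hits M u v t ≡ 0

  Uncovered-cong : ∀ {M M′ a b} → (∀ x → x < ν * W → M x ≡ M′ x) →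
                   Uncovered M a b → Uncovered M′ a b
  Uncovered-cong M≗M′ (uncovered u<ν v<ν 1≤i i+Δ≤W eu ev occ unhit) =
    uncovered u<ν v<ν 1≤i i+Δ≤W eu ev occ λ t t∈W act →
      trans (sym (cong₂ _+_
        (M≗M′ _ (cell-bound u<ν (InWindow⇒<W i+Δ≤W t∈W)))
        (M≗M′ _ (cell-bound v<ν (InWindow⇒<W i+Δ≤W t∈W))))) (unhit t t∈W act)

  -- The child number c of a node marks offset c of the row of u when c < Δ, and
  -- offset c - Δ of the row of v otherwise.
  target : ℕ → ℕ → ℕ → ℕ
  target startU startV c = if does (c <? Δ) then startU + c else startV + (c ∸ Δ)

  target-U : ∀ a b {c} → c < Δ → target a b c ≡ a + c
  target-U a b {c} c<Δ = cong (if_then a + c else b + (c ∸ Δ)) (dec-true (c <? Δ) c<Δ)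

  target-V : ∀ a b {c} → Δ ≤ c → target a b c ≡ b + (c ∸ Δ)
  target-V a b {c} Δ≤c = cong (if_then a + c else b + (c ∸ Δ)) (dec-false (c <? Δ) (≤⇒≯ Δ≤c))

  -- Nodes are numbered as in a heap: the children of p are 1 + (p * B + c) with c < B.
  record Tree (mark : ℕ → ℕ → ℕ) (startU startV : ℕ → ℕ) (j : ℕ) : Set where
    field
      root  : ∀ x → x < ν * W → mark 0 x ≡ 0
      child : ∀ p c → c < B → p * B + c < j → ∀ x → x < ν * W →
              mark (suc (p * B + c)) x ≡
              (if does (x ≟ target (startU p) (startV p) c) then 1 else mark p x)
      open-before : ∀ i → i < j → Uncovered (mark i) (startU i) (startV i)

  -- A cover seen as a bare list of cells, with no demand of distinctness, so that the list of all
  -- cells can serve as well as a minimum cover.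
  Hitting : List ℕ → Set
  Hitting S = ∀ u → u < ν → ∀ v → v < ν → ∀ i → 1 ≤ i → i + Δ ≤ W →
    ∀ t → InWindow i t → Active u v t →
    ∃[ t′ ] (InWindow i t′ × Active u v t′ × (cell u t′ ∈ S ⊎ cell v t′ ∈ S))

  -- The number of the last node on level d.
  last : ℕ → ℕ
  last zero    = 0
  last (suc d) = last d * B + B

  module _ (2≤Δ : 2 ≤ Δ) where

    2≤B : 2 ≤ B
    2≤B = ≤-trans 2≤Δ (m≤m+n Δ _)

    instance
      nonZero-B : NonZero B
      nonZero-B = >-nonZero (≤-trans (s≤s z≤n) 2≤B)

    last-step : ∀ d → last d ≤ last (suc d)
    last-step d = ≤-trans (m≤m*n (last d) B) (m≤m+n _ B)

    last-mono : ∀ r d → last d ≤ last (r + d)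
    last-mono zero    d = ≤-refl
    last-mono (suc r) d = ≤-trans (last-mono r d) (last-step (r + d))

    -- `last d` is the geometric sum B + ... + B^d. The summand 2 makes the induction close: as
    -- `2 ≤ B` it may be raised to `B`, and `B + (last d * B + B)` is `B * (2 + last d)`.
    last-bound : ∀ d → 2 + last d ≤ 2 * B ^ d
    last-bound zero    = ≤-refl
    last-bound (suc d) = begin
      2 + (last d * B + B)    ≤⟨ +-monoˡ-≤ _ 2≤B ⟩
      B + (last d * B + B)    ≡⟨ identity (last d) B ⟩
      B * (2 + last d)        ≤⟨ *-monoʳ-≤ B (last-bound d) ⟩
      B * (2 * B ^ d)         ≡⟨ identity′ B (B ^ d) ⟩
      2 * (B * B ^ d)         ∎
      where
      open ≤-Reasoning
      identity : ∀ l b → b + (l * b + b) ≡ b * (2 + l)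
      identity = solve-∀
      identity′ : ∀ b c → b * (2 * c) ≡ 2 * (b * c)
      identity′ = solve-∀

    module _ {mark startU startV j} (tree : Tree mark startU startV j) where
      open Tree tree

      -- D collects the targets along the path from node i to the root, which has at most d edges;
      -- quotient and remainder by `B` recover the parent and the child number.
      few-marks : ∀ d i → i ≤ j → i ≤ last d →
                  ∃[ D ] (length D ≤ d × (∀ x → x < ν * W → mark i x ≢ 0 → x ∈ D))
      few-marks d zero _ _ = [] , z≤n , λ x x< ≢0 → contradiction (root x x<) ≢0
      few-marks (suc d) (suc i) i<j (i<) =
        subst (λ k → ∃[ D ] (length D ≤ suc d × (∀ x → x < ν * W → mark (suc k) x ≢ 0 → x ∈ D)))
              (sym i≡) (extend (few-marks d p p≤j p≤))
        where
        open ≤-Reasoning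
        p = i / B
        c = i % B
        i≡ : i ≡ p * B + c
        i≡ = trans (m≡m%n+[m/n]*n i B) (+-comm c (p * B))
        p≤i : p ≤ i
        p≤i = ≤-trans (m≤m*n p B) (≤-trans (m≤m+n (p * B) c) (≤-reflexive (sym i≡)))
        p≤j : p ≤ j
        p≤j = ≤-trans p≤i (<⇒≤ i<j)
        p≤ : p ≤ last d
        p≤ = s≤s⁻¹ (*-cancelʳ-< B p (suc (last d)) (begin-strict
          p * B              ≤⟨ m≤m+n (p * B) c ⟩
          p * B + c          ≡⟨ sym i≡ ⟩
          i                  <⟨ i< ⟩
          last d * B + B     ≡⟨ +-comm (last d * B) B ⟩
          suc (last d) * B   ∎))
        q = target (startU p) (startV p) c
        extend : ∃[ D ] (length D ≤ d × (∀ x → x < ν * W → mark p x ≢ 0 → x ∈ D)) →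
                 ∃[ D ] (length D ≤ suc d × (∀ x → x < ν * W → mark (suc (p * B + c)) x ≢ 0 → x ∈ D))
        extend (D , len , f) = q ∷ D , s≤s len , g
          where
          g : ∀ x → x < ν * W → mark (suc (p * B + c)) x ≢ 0 → x ∈ q ∷ D
          g x x< ≢0 with x ≟ q
          ... | yes x≡q = here x≡q
          ... | no x≢q = there (f x x< λ ≡0 → ≢0 (trans
            (child p c (m%n<n i B) (subst (_< j) i≡ i<j) x x<) (trans (override-≢ x≢q) ≡0)))

      module _ {S : List ℕ} (hitting : Hitting S) where

        -- R holds the elements of S that may still be unmarked; its length bounds the number of
        -- steps left to descend.
        MarkedOr∈ : ℕ → List ℕ → Set
        MarkedOr∈ i R = ∀ x → x < ν * W → x ∈ S → mark i x ≢ 0 ⊎ x ∈ R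

        marked-child : ∀ {i R c x} → c < B → i * B + c < j → x ≡ target (startU i) (startV i) c →
                       MarkedOr∈ i R → (x∈R : x ∈ R) → MarkedOr∈ (suc (i * B + c)) (R ─ x∈R)
        marked-child {i} {R} {c} {x} c<B <j x≡ inv x∈R y y< y∈S with y ≟ x | inv y y< y∈S
        ... | yes refl | _ = inj₁ λ ≡0 → contradiction
          (trans (sym ≡0) (trans (child i c c<B <j y y<) (override-≡ x≡))) λ ()
        ... | no y≢x | inj₁ ≢0 = inj₁ λ ≡0 → ≢0
          (trans (sym (trans (child i c c<B <j y y<) (override-≢ λ y≡ → y≢x (trans y≡ (sym x≡))))) ≡0)
        ... | no y≢x | inj₂ y∈R = inj₂ (∈-─ x∈R y∈R y≢x)

        -- The element of S that hits the uncovered window of node i is still unmarked.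
        missing : ∀ {i} → i < j → ∃[ c ] (c < B ×
                  target (startU i) (startV i) c < ν * W ×
                  target (startU i) (startV i) c ∈ S ×
                  mark i (target (startU i) (startV i) c) ≡ 0)
        missing {i} i<j with open-before i i<j
        ... | uncovered {u} {v} {k} u<ν v<ν 1≤k k+Δ≤W eu ev (t , t∈W , act) unhit
          with hitting u u<ν v v<ν k 1≤k k+Δ≤W t t∈W act
        ... | t′ , t′∈W@(k≤t′ , t′<k+Δ) , act′ , cell∈S = go cell∈S
          where
          o = t′ ∸ k
          k+o : k + o ≡ t′
          k+o = m+[n∸m]≡n k≤t′
          o<Δ : o < Δ
          o<Δ = +-cancelˡ-< k o Δ (subst (_< k + Δ) (sym k+o) t′<k+Δ)
          shift : ∀ {a} w → a ≡ cell w k → a + o ≡ cell w t′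
          shift w refl = trans (+-assoc (w * W) k o) (cong (w * W +_) k+o)
          t′<W = InWindow⇒<W k+Δ≤W t′∈W
          unmarked : hits (mark i) u v t′ ≡ 0
          unmarked = unhit t′ t′∈W act′
          Goal : ℕ → ℕ → Set
          Goal c q = c < B × q < ν * W × q ∈ S × mark i q ≡ 0
          wrap : ∀ c q → target (startU i) (startV i) c ≡ q → Goal c q →
                 ∃[ c ] Goal c (target (startU i) (startV i) c)
          wrap c q refl g = c , g
          go : cell u t′ ∈ S ⊎ cell v t′ ∈ S → ∃[ c ] Goal c (target (startU i) (startV i) c)
          go (inj₁ ∈S) = wrap o (cell u t′)
            (trans (target-U (startU i) (startV i) o<Δ) (shift u eu))
            ( ≤-trans o<Δ (m≤m+n Δ _) , cell-bound u<ν t′<W , ∈S , m+n≡0⇒m≡0 _ unmarked)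
          go (inj₂ ∈S) = wrap (Δ + o) (cell v t′)
            (trans (target-V (startU i) (startV i) (m≤m+n Δ o))
              (trans (cong (startV i +_) (m+n∸m≡n Δ o)) (shift v ev)))
            ( subst (Δ + o <_) (cong (Δ +_) (sym (+-identityʳ Δ))) (+-monoʳ-< Δ o<Δ)
            , cell-bound v<ν t′<W , ∈S , m+n≡0⇒n≡0 (mark i (cell u t′)) unmarked)

        -- From an open node the child given by `missing` marks an element of S and so shortens R,
        -- while an empty R would contradict `missing`. Hence the walk leaves the open nodes within
        -- r steps, on level r + d at the latest, and j is at most the last number of that level.
        descend : ∀ r d i R → length R ≡ r → MarkedOr∈ i R → i ≤ last d → j ≤ last (r + d)
        descend r d i R len inv i≤ with j ≤? i
        ... | yes j≤i = ≤-trans j≤i (≤-trans i≤ (last-mono r d))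
        ... | no j≰i with missing (≰⇒> j≰i)
        ... | c , c<B , q< , q∈S , ≡0 with inv _ q< q∈S
        ... | inj₁ ≢0 = contradiction ≡0 ≢0
        ... | inj₂ q∈R = descend′ r len
          where
          open ≤-Reasoning
          R′ = R ─ q∈R
          i′≤ : suc (i * B + c) ≤ last (suc d)
          i′≤ = begin
            suc (i * B + c)    ≡⟨ sym (+-suc (i * B) c) ⟩
            i * B + suc c      ≤⟨ +-mono-≤ (*-monoˡ-≤ B i≤) c<B ⟩
            last d * B + B     ∎
          descend′ : ∀ r → length R ≡ r → j ≤ last (r + d)
          descend′ zero eq with () ← trans (sym eq) (length-removeAt′ R (index q∈R))
          descend′ (suc r) eq with j ≤? i * B + c
          -- The child is not yet in the tree, but its number already exceeds j and is at most
          -- `last (suc d)`.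
          ... | yes j≤ = ≤-trans j≤ (≤-trans (n≤1+n _) (≤-trans i′≤
                  (subst (λ e → last (suc d) ≤ last e) (+-suc r d) (last-mono r (suc d)))))
          ... | no j≰ = subst (λ e → j ≤ last e) (+-suc r d)
            (descend r (suc d) (suc (i * B + c)) R′
              (suc-injective (trans (sym (length-removeAt′ R (index q∈R))) eq))
              (marked-child c<B (≰⇒> j≰) refl inv q∈R) i′≤)

        node-bound : j ≤ last (length S)
        node-bound = subst (λ e → j ≤ last e) (+-identityʳ (length S))
          (descend (length S) 0 0 S refl (λ x _ x∈S → inj₂ x∈S) z≤n)

-- Scanning for an uncovered window

-- `marks`, `winU` and `winV` are genuine arrays, the names after them scalars. `base` is the
-- address of the marks of the current node, `pbase` that of the marks of the parent of the next
-- node.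
input output marks winU winV stride block node base parent pbase child found posU posV : ℕ
input  = 0
output = 1
marks  = 2
winU   = 3
winV   = 4
stride = 5
block  = 6
node   = 7
base   = 8
parent = 9
pbase  = 10
child  = 11
found  = 12
posU   = 13
posV   = 14

idxU idxV time rowU rowV ptr lastActive lastHit idxX : ℕ
idxU       = 15
idxV       = 16
time       = 17
rowU       = 18
rowV       = 19
ptr        = 20
lastActive = 21
lastHit    = 22
idxX       = 23

[Δ] [n] [T] now : Exp
[Δ] = input ⟨ lit 0 ⟩
[n] = input ⟨ lit 1 ⟩
[T] = input ⟨ lit 2 ⟩
now = lit 1 ⊕ var time

markNow : ℕ → Exp
markNow row = marks ⟨ var base ⊕ (var row ⊕ now) ⟩

noteLabel testWindow scanPair scan : Program
noteLabel =
  if≢0 (input ⟨ var ptr ⊕ now ⟩)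
    (lastActive ≔ now ⨾
     if≢0 (markNow rowU ⊕ markNow rowV) (lastHit ≔ now) skip)
    skip
-- The window ending now lacks a hit iff lastHit + Δ ≤ now, which also forces it
-- to start at time 1 or later; it has a label iff now < lastActive + Δ.
testWindow =
  if≢0 ((var lastHit ⊕ [Δ]) ⊖ now) skip
    (if≢0 ((var lastActive ⊕ [Δ]) ⊖ now)
       (posU ≔ var rowU ⊕ ((lit 1 ⊕ now) ⊖ [Δ]) ⨾
        posV ≔ var rowV ⊕ ((lit 1 ⊕ now) ⊖ [Δ]) ⨾
        found ≔ lit 1)
       skip)
scanPair =
  lastActive ≔ lit 0 ⨾ lastHit ≔ lit 0 ⨾
  for time [T] (noteLabel ⨾ testWindow)
scan =
  found ≔ lit 0 ⨾ ptr ≔ lit 3 ⨾ rowU ≔ lit 0 ⨾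
  for idxU [n]
    (rowV ≔ lit 0 ⨾
     for idxV [n]
       (scanPair ⨾ ptr ≔ var ptr ⊕ var stride ⨾ rowV ≔ var rowV ⊕ var stride) ⨾
     rowU ≔ var rowU ⊕ var stride)

∸≢0⇒< : ∀ {m n} → m ∸ n ≢ 0 → n < m
∸≢0⇒< ≢0 = ≰⇒> λ m≤n → ≢0 (m≤n⇒m∸n≡0 m≤n)

-- The value 0 means that no such time has occurred; since only positive times count, it cannot be
-- confused with one.
record Latest (P : ℕ → Set) (m a : ℕ) : Set where
  field
    bound  : a ≤ m
    holds  : a ≢ 0 → P a
    latest : ∀ t → 1 ≤ t → t ≤ m → P t → t ≤ a
open Latest

latest-zero : ∀ {P} → Latest P 0 0
latest-zero .bound = z≤n
latest-zero .holds ≢0 = contradiction refl ≢0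
latest-zero .latest t _ t≤0 _ = t≤0

latest-hit : ∀ {P m} → P (suc m) → Latest P (suc m) (suc m)
latest-hit p .bound = ≤-refl
latest-hit p .holds _ = p
latest-hit p .latest _ _ t≤ _ = t≤

latest-miss : ∀ {P : ℕ → Set} {m a} → ¬ P (suc m) → Latest P m a → Latest P (suc m) a
latest-miss ¬p l .bound = m≤n⇒m≤1+n (l .bound)
latest-miss ¬p l .holds = l .holds
latest-miss {m = m} ¬p l .latest t 1≤t t≤ pt with t ≟ suc m
... | yes refl = contradiction pt ¬p
... | no t≢ = l .latest t 1≤t (s≤s⁻¹ (≤∧≢⇒< t≤ t≢)) pt

-- n and T are nonzero here because they become factors of the time unit; a nonzero T will be
-- ensured by a test at the start of the program.
module Scan (A : ℕ → ℕ) .{{_ : NonZero (A 1)}} .{{_ : NonZero (A 2)}} where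
  open Search A

  -- The scan runs on after a find, and a later uncovered window overwrites the earlier one. So X,
  -- the coverage established so far, is claimed only while nothing has been found.
  Status : (ℕ → ℕ) → ℕ → ℕ → ℕ → Set → Set
  Status M f a b X = (f ≢ 0 × Uncovered M a b) ⊎ (f ≡ 0 × X)

  Status-frame : ∀ {M X P s s′} → keeps found P ≡ true → keeps posU P ≡ true → keeps posV P ≡ true →
                 Frame P s s′ → Status M (s found 0) (s posU 0) (s posV 0) X →
                 Status M (s′ found 0) (s′ posU 0) (s′ posV 0) X
  Status-frame k₁ k₂ k₃ fr
    rewrite fr .at found k₁ 0 | fr .at posU k₂ 0 | fr .at posV k₃ 0 = λ st → st

  Hit : (ℕ → ℕ) → ℕ → ℕ → ℕ → Set
  Hit M u v t = Active u v t × hits M u v t ≢ 0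

  -- `i + Δ ≤ suc m` says that the window ends by time m. At most one window ends at each time, so
  -- one test per time suffices. X carries the coverage of the pairs scanned before.
  TimeInv : (ℕ → ℕ) → ℕ → ℕ → Set → ℕ → State → Set
  TimeInv M u v X m s =
    Latest (Active u v) m (s lastActive 0) × Latest (Hit M u v) m (s lastHit 0) ×
    Status M (s found 0) (s posU 0) (s posV 0)
      (X × (∀ i → 1 ≤ i → i + Δ ≤ suc m → CoveredIn M u v i))

  record At (M : ℕ → ℕ) (u v : ℕ) (s : State) : Set where
    field
      input≡ : ∀ y → s input y ≡ A y
      marks≡ : ∀ x → s marks (s base 0 + x) ≡ M x
      rowU≡  : s rowU 0 ≡ u * W
      rowV≡  : s rowV 0 ≡ v * W
      ptr≡   : s ptr 0 ≡ 3 + (u * ν + v) * W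

  At-frame : ∀ {M u v P s s′} → keeps input P ≡ true → keeps marks P ≡ true → keeps base P ≡ true →
             keeps rowU P ≡ true → keeps rowV P ≡ true → keeps ptr P ≡ true →
             Frame P s s′ → At M u v s → At M u v s′
  At-frame {s = s} k₁ k₂ k₃ k₄ k₅ k₆ fr h = record
    { input≡ = λ y → trans (fr .at input k₁ y) (input≡ y)
    ; marks≡ = λ x → trans (fr .at marks k₂ _) (trans (cong (λ b → s marks (b + x)) (fr .at base k₃ 0)) (marks≡ x))
    ; rowU≡  = trans (fr .at rowU k₄ 0) rowU≡
    ; rowV≡  = trans (fr .at rowV k₅ 0) rowV≡
    ; ptr≡   = trans (fr .at ptr k₆ 0) ptr≡
    }
    where open At h

  module _ {M : ℕ → ℕ} {u v : ℕ} {X : Set} (u<ν : u < ν) (v<ν : v < ν) where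

    noteLabel-run : ∀ {s} → At M u v s → TimeInv M u v X (s time 0) s →
      Run noteLabel s 1 λ s′ →
        Latest (Active u v) (suc (s time 0)) (s′ lastActive 0) ×
        Latest (Hit M u v) (suc (s time 0)) (s′ lastHit 0)
    noteLabel-run {s} h (la , lh , _) = if-run
      (λ ≢0 → let act = λ ≡0 → ≢0 (trans active≡ ≡0) in
        set-then (if-run
          (λ ≢0′ → set-run (latest-hit act , latest-hit (act , λ ≡0 → ≢0′ (trans hits≡ ≡0))))
          (λ ≡0 → skip-run (latest-hit act ,
                            latest-miss (λ (_ , ≢0) → contradiction (trans (sym hits≡) ≡0) ≢0) lh))))
      (λ ≡0 → skip-run (latest-miss (λ act → contradiction (trans (sym active≡) ≡0) act) la ,
                        latest-miss (λ (act , _) → contradiction (trans (sym active≡) ≡0) act) lh))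
      where
      open At h
      m = s time 0
      active≡ : s input (s ptr 0 + suc m) ≡ A (3 + ((u * ν + v) * W + suc m))
      active≡ = trans (input≡ _) (cong (λ p → A (p + suc m)) ptr≡)
      hits≡ : s marks (s base 0 + (s rowU 0 + suc m)) + s marks (s base 0 + (s rowV 0 + suc m)) ≡
              hits M u v (suc m)
      hits≡ = cong₂ _+_ (trans (marks≡ _) (cong (λ r → M (r + suc m)) rowU≡))
                        (trans (marks≡ _) (cong (λ r → M (r + suc m)) rowV≡))

    testWindow-run : ∀ {s m} → At M u v s → s time 0 ≡ m → m < T →
      Latest (Active u v) (suc m) (s lastActive 0) → Latest (Hit M u v) (suc m) (s lastHit 0) →
      Status M (s found 0) (s posU 0) (s posV 0)
        (X × (∀ i → 1 ≤ i → i + Δ ≤ suc m → CoveredIn M u v i)) →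
      Run testWindow s 1 (TimeInv M u v X (suc m))
    testWindow-run {s} h refl m<T la lh status = if-run
      (λ ≢0 → skip-run (la , lh , extend (covered-by-hit (<h ≢0))))
      (λ ≡0 → if-run
        (λ ≢0 → set-then (set-then (set-run
          (la , lh , inj₁ ((λ ()) , new-window (h≤ ≡0) (<a ≢0))))))
        (λ ≡0′ → skip-run (la , lh , extend (no-label (a≤ ≡0′)))))
      where
      open At h
      m = s time 0
      a = s lastActive 0
      c = s lastHit 0
      Δ≡ : s input 0 ≡ Δ
      Δ≡ = input≡ 0
      <h : c + s input 0 ∸ suc m ≢ 0 → suc m < c + Δ
      <h ≢0 = subst (λ d → suc m < c + d) Δ≡ (∸≢0⇒< ≢0)
      h≤ : c + s input 0 ∸ suc m ≡ 0 → c + Δ ≤ suc m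
      h≤ ≡0 = subst (λ d → c + d ≤ suc m) Δ≡ (m∸n≡0⇒m≤n ≡0)
      <a : a + s input 0 ∸ suc m ≢ 0 → suc m < a + Δ
      <a ≢0 = subst (λ d → suc m < a + d) Δ≡ (∸≢0⇒< ≢0)
      a≤ : a + s input 0 ∸ suc m ≡ 0 → a + Δ ≤ suc m
      a≤ ≡0 = subst (λ d → a + d ≤ suc m) Δ≡ (m∸n≡0⇒m≤n ≡0)

      extend : (∀ i → 1 ≤ i → i + Δ ≡ suc (suc m) → CoveredIn M u v i) →
               Status M (s found 0) (s posU 0) (s posV 0)
                 (X × (∀ i → 1 ≤ i → i + Δ ≤ suc (suc m) → CoveredIn M u v i))
      extend new = Sum.map₂ (λ (≡0 , x , old) → ≡0 , x , λ i 1≤i i+Δ≤ → split i 1≤i i+Δ≤ old) status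
        where
        split : ∀ i → 1 ≤ i → i + Δ ≤ suc (suc m) →
                (∀ i → 1 ≤ i → i + Δ ≤ suc m → CoveredIn M u v i) → CoveredIn M u v i
        split i 1≤i i+Δ≤ old with i + Δ ≟ suc (suc m)
        ... | yes eq = new i 1≤i eq
        ... | no neq = old i 1≤i (s≤s⁻¹ (≤∧≢⇒< i+Δ≤ neq))

      covered-by-hit : suc m < c + Δ → ∀ i → 1 ≤ i → i + Δ ≡ suc (suc m) → CoveredIn M u v i
      covered-by-hit m<c+Δ i 1≤i i+Δ≡ t t∈W act =
        -- `1 ≤ i ≤ c` excludes the default value 0 of the last hit, so c is a genuine hit.
        c , (i≤c , subst (c <_) (sym i+Δ≡) (s≤s (lh .bound))) , lh .holds (>⇒≢ (≤-trans 1≤i i≤c))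
        where
        i≤c : i ≤ c
        i≤c = +-cancelʳ-≤ Δ i c (≤-trans (≤-reflexive i+Δ≡) m<c+Δ)

      no-label : a + Δ ≤ suc m → ∀ i → 1 ≤ i → i + Δ ≡ suc (suc m) → CoveredIn M u v i
      no-label a+Δ≤ i 1≤i i+Δ≡ t (i≤t , t<) act = contradiction a<a (<-irrefl refl)
        where
        -- A label t in the window has `i ≤ t ≤ a`, while the window reaches beyond `a + Δ`: a + Δ <
        -- i + Δ ≤ a + Δ.
        a<a : a < a
        a<a = +-cancelʳ-< Δ a a (≤-trans (s≤s a+Δ≤) (≤-trans (≤-reflexive (sym i+Δ≡))
          (+-monoˡ-≤ Δ (≤-trans i≤t (la .latest t (≤-trans 1≤i i≤t)
            (s≤s⁻¹ (subst (t <_) i+Δ≡ t<)) act)))))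

      new-window : c + Δ ≤ suc m → suc m < a + Δ →
                   Uncovered M (s rowU 0 + (suc (suc m) ∸ s input 0)) (s rowV 0 + (suc (suc m) ∸ s input 0))
      new-window c+Δ≤ m<a+Δ = uncovered u<ν v<ν 1≤i
          (≤-trans (≤-reflexive i+Δ≡) (s≤s m<T))
          (cong₂ _+_ rowU≡ (cong (suc (suc m) ∸_) Δ≡)) (cong₂ _+_ rowV≡ (cong (suc (suc m) ∸_) Δ≡))
          (a , (i≤a , subst (a <_) (sym i+Δ≡) (s≤s (la .bound))) , la .holds (>⇒≢ (≤-trans 1≤i i≤a)))
          none
        where
        i = suc (suc m) ∸ Δ
        Δ≤ : Δ ≤ suc m
        Δ≤ = ≤-trans (m≤n+m Δ c) c+Δ≤
        i+Δ≡ : i + Δ ≡ suc (suc m)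
        i+Δ≡ = m∸n+n≡m (m≤n⇒m≤1+n Δ≤)
        1≤i : 1 ≤ i
        1≤i = m<n⇒0<n∸m (s≤s Δ≤)
        i≤a : i ≤ a
        i≤a = +-cancelʳ-≤ Δ i a (≤-trans (≤-reflexive i+Δ≡) m<a+Δ)
        none : ∀ t → InWindow i t → Active u v t → hits M u v t ≡ 0
        none t (i≤t , t<) act with hits M u v t ≟ 0
        ... | yes ≡0 = ≡0
        ... | no ≢0 = contradiction (≤-trans (s≤s c+Δ≤) (≤-trans (≤-reflexive (sym i+Δ≡))
              (+-monoˡ-≤ Δ (≤-trans i≤t (lh .latest t (≤-trans 1≤i i≤t)
                (s≤s⁻¹ (subst (t <_) i+Δ≡ t<)) (act , ≢0)))))) (<-irrefl refl)

    scanPair-run : ∀ {s} → At M u v s → Status M (s found 0) (s posU 0) (s posV 0) X →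
      Run scanPair s (T * 1) λ s′ →
        Status M (s′ found 0) (s′ posU 0) (s′ posV 0) (X × CoveredPair M u v)
    scanPair-run {s} h status = set-then (set-then (map-run (λ _ _ (_ , _ , st) → st)
      (for-run T (TimeInv M u v X) refl
        (λ s′ fr → trans (fr .at input refl 2) (H.input≡ 2))
        (latest-zero , latest-zero , Sum.map₂ (λ (≡0 , x) → ≡0 , x , λ i 1≤i i+Δ≤1 t (i≤t , t<) →
          contradiction (≤-trans 1≤i i≤t) (<⇒≱ (≤-trans t< i+Δ≤1))) status)
        round)))
      where
      instance _ = m*n≢0 T 1
      module H = At h
      s₀ = store lastHit 0 0 (store lastActive 0 0 s)
      round : ∀ m s′ → m < T → s′ time 0 ≡ m → Frame (for time [T] (noteLabel ⨾ testWindow)) s₀ s′ →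
              TimeInv M u v X m s′ →
              Run (noteLabel ⨾ testWindow) s′ 1 (TimeInv M u v X (suc m))
      round m s′ m<T refl fr inv@(_ , _ , st) = seq-run (noteLabel-run h′ inv) λ s″ fr″ (la , lh) →
        testWindow-run (At-frame refl refl refl refl refl refl fr″ h′) (fr″ .at time refl 0) m<T la lh
          (Status-frame refl refl refl fr″ st)
        where
        h′ : At M u v s′
        h′ = At-frame refl refl refl refl refl refl fr (record { H })

  record Ready (M : ℕ → ℕ) (s : State) : Set where
    field
      input≡  : ∀ y → s input y ≡ A y
      stride≡ : s stride 0 ≡ W
      marks≡  : ∀ x → s marks (s base 0 + x) ≡ M x

  Ready-frame : ∀ {M P s s′} → keeps input P ≡ true → keeps stride P ≡ true →
                keeps marks P ≡ true → keeps base P ≡ true → Frame P s s′ → Ready M s → Ready M s′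
  Ready-frame {s = s} k₁ k₂ k₃ k₄ fr h = record
    { input≡  = λ y → trans (fr .at input k₁ y) (input≡ y)
    ; stride≡ = trans (fr .at stride k₂ 0) stride≡
    ; marks≡  = λ x → trans (fr .at marks k₃ _)
                        (trans (cong (λ b → s marks (b + x)) (fr .at base k₄ 0)) (marks≡ x))
    }
    where open Ready h

  RowInv : (ℕ → ℕ) → ℕ → State → Set
  RowInv M u s =
    s rowU 0 ≡ u * W × s ptr 0 ≡ 3 + u * ν * W ×
    Status M (s found 0) (s posU 0) (s posV 0) (∀ u′ → u′ < u → ∀ v → v < ν → CoveredPair M u′ v)

  ColumnInv : (ℕ → ℕ) → ℕ → ℕ → State → Set
  ColumnInv M u v s =
    s rowU 0 ≡ u * W × s rowV 0 ≡ v * W × s ptr 0 ≡ 3 + (u * ν + v) * W ×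
    Status M (s found 0) (s posU 0) (s posV 0)
      ((∀ u′ → u′ < u → ∀ v → v < ν → CoveredPair M u′ v) × (∀ v′ → v′ < v → CoveredPair M u v′))

  below-suc : ∀ {P : ℕ → Set} {m} → (∀ k → k < m → P k) → P m → ∀ k → k < suc m → P k
  below-suc {m = m} below pm k k<1+m with k ≟ m
  ... | yes refl = pm
  ... | no k≢m = below k (≤∧≢⇒< (s≤s⁻¹ k<1+m) k≢m)

  instance
    nonZero-T*1 : NonZero (T * 1)
    nonZero-T*1 = m*n≢0 T 1
    nonZero-row : NonZero (ν * (T * 1))
    nonZero-row = m*n≢0 ν (T * 1)
    nonZero-all : NonZero (ν * (ν * (T * 1)))
    nonZero-all = m*n≢0 ν (ν * (T * 1))

  column-run : ∀ {M u v s} → u < ν → v < ν → Ready M s → ColumnInv M u v s →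
    Run (scanPair ⨾ ptr ≔ var ptr ⊕ var stride ⨾ rowV ≔ var rowV ⊕ var stride) s (T * 1)
        (ColumnInv M u (suc v))
  column-run {M} {u} {v} u<ν v<ν h (rowU≡ , rowV≡ , ptr≡ , st) =
    seq-run (scanPair-run u<ν v<ν
      (record { rowU≡ = rowU≡ ; rowV≡ = rowV≡ ; ptr≡ = ptr≡ ; H }) st)
    λ s′ fr st′ → set-then (set-run
      ( trans (fr .at rowU refl 0) rowU≡
      , trans (cong₂ _+_ (trans (fr .at rowV refl 0) rowV≡) (trans (fr .at stride refl 0) H.stride≡))
              (+-comm (v * W) W)
      , trans (cong₂ _+_ (trans (fr .at ptr refl 0) ptr≡) (trans (fr .at stride refl 0) H.stride≡))
              (cong (3 +_) (trans (+-comm ((u * ν + v) * W) W) (cong (_* W) (sym (+-suc (u * ν) v)))))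
      , Sum.map₂ (λ (≡0 , (rows , columns) , cov) → ≡0 , rows , below-suc columns cov) st′))
    where module H = Ready h

  row-run : ∀ {M u s} → u < ν → Ready M s → RowInv M u s →
    Run (rowV ≔ lit 0 ⨾
         for idxV [n]
           (scanPair ⨾ ptr ≔ var ptr ⊕ var stride ⨾ rowV ≔ var rowV ⊕ var stride) ⨾
         rowU ≔ var rowU ⊕ var stride) s (ν * (T * 1)) (RowInv M (suc u))
  row-run {M} {u} {s} u<ν h (rowU≡ , ptr≡ , st) = set-then (seq-run
    (for-run ν (ColumnInv M u) refl
      (λ s′ fr → trans (fr .at input refl 1) (H.input≡ 1))
      ( rowU≡ , refl , trans ptr≡ (cong (λ k → 3 + k * W) (sym (+-identityʳ (u * ν))))
      , Sum.map₂ (λ (≡0 , rows) → ≡0 , rows , λ _ ()) st)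
      λ v s′ v<ν _ fr inv →
        column-run u<ν v<ν (Ready-frame refl refl refl refl fr (record { H })) inv)
    λ s′ fr (rowU≡′ , _ , ptr≡′ , st′) → set-run
      ( trans (cong₂ _+_ rowU≡′ (trans (fr .at stride refl 0) H.stride≡)) (+-comm (u * W) W)
      , trans ptr≡′ (cong (λ k → 3 + k * W) (+-comm (u * ν) ν))
      , Sum.map₂ (λ (≡0 , rows , columns) → ≡0 , below-suc rows columns) st′))
    where module H = Ready h

  scan-run : ∀ {M s} → Ready M s → Run scan s (ν * (ν * (T * 1)))
    (λ s′ → Status M (s′ found 0) (s′ posU 0) (s′ posV 0) (Covered M))
  scan-run {M} h = set-then (set-then (set-then (map-run (λ _ _ (_ , _ , st) → st)
    (for-run ν (RowInv M) refl
      (λ s′ fr → trans (fr .at input refl 1) (H.input≡ 1))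
      (refl , refl , inj₂ (refl , λ _ ()))
      λ u s′ u<ν _ fr inv → row-run u<ν (Ready-frame refl refl refl refl fr (record { H })) inv))))
    where module H = Ready h

-- The search

divMod-unique : ∀ {d p p′ c c′} → c < d → c′ < d → p * d + c ≡ p′ * d + c′ → p ≡ p′ × c ≡ c′
divMod-unique {d@(suc _)} {p} {p′} {c} {c′} c<d c′<d eq =
  *-cancelʳ-≡ p p′ d (+-cancelʳ-≡ c (p * d) (p′ * d) (trans eq (cong (p′ * d +_) (sym c≡c′)))) , c≡c′
  where
  open ≡-Reasoning
  c≡c′ : c ≡ c′
  c≡c′ = begin
    c                   ≡⟨ sym (m<n⇒m%n≡m c<d) ⟩
    c % d               ≡⟨ sym ([m+kn]%n≡m%n c p d) ⟩
    (c + p * d) % d     ≡⟨ cong (_% d) (trans (+-comm c (p * d)) (trans eq (+-comm (p′ * d) c′))) ⟩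
    (c′ + p′ * d) % d   ≡⟨ [m+kn]%n≡m%n c′ p′ d ⟩
    c′ % d              ≡⟨ m<n⇒m%n≡m c′<d ⟩
    c′                  ∎

-- `expand` creates the next node in the numbering, whose parent is in general much older than the
-- node just scanned. The window found is therefore stored under the number of the scanned node, for
-- its own children to use later.
copyParent markChild nextChild expand search : Program
copyParent = for idxX (var block)
  (marks ⟨ var base ⊕ var idxX ⟩≔ marks ⟨ var pbase ⊕ var idxX ⟩)
markChild = if≢0 ([Δ] ⊖ var child)
  (marks ⟨ var base ⊕ (winU ⟨ var parent ⟩ ⊕ var child) ⟩≔ lit 1)
  (marks ⟨ var base ⊕ (winV ⟨ var parent ⟩ ⊕ (var child ⊖ [Δ])) ⟩≔ lit 1)
nextChild =
  child ≔ lit 1 ⊕ var child ⨾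
  if≢0 (([Δ] ⊕ [Δ]) ⊖ var child)
    skip
    (child ≔ lit 0 ⨾ parent ≔ lit 1 ⊕ var parent ⨾ pbase ≔ var pbase ⊕ var block)
expand =
  winU ⟨ var node ⟩≔ var posU ⨾ winV ⟨ var node ⟩≔ var posV ⨾
  node ≔ lit 1 ⊕ var node ⨾ base ≔ var base ⊕ var block ⨾
  copyParent ⨾ markChild ⨾ nextChild
search = scan ⨾ while≢0 (var found) (expand ⨾ scan)

module Main (A : ℕ → ℕ) .{{_ : NonZero (A 1)}} .{{_ : NonZero (A 2)}} (2≤Δ : 2 ≤ A 0) where
  open Search A
  open Scan A

  N : ℕ
  N = ν * W

  -- The functions describe memory, which changes beyond node j; the new ones need to agree with the
  -- old ones only where the old tree looks.
  Tree-extend : ∀ {mark mark′ a a′ b b′ j p c pu pv} → Tree mark a b j → j ≡ p * B + c → c < B →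
    Uncovered (mark j) pu pv →
    (∀ i x → i ≤ j → x < N → mark′ i x ≡ mark i x) →
    (∀ i → i < j → a′ i ≡ a i) → (∀ i → i < j → b′ i ≡ b i) → a′ j ≡ pu → b′ j ≡ pv →
    (∀ x → x < N → mark′ (suc j) x ≡ (if does (x ≟ target (a′ p) (b′ p) c) then 1 else mark p x)) →
    Tree mark′ a′ b′ (suc j)
  Tree-extend {mark} {mark′} {a} {a′} {b} {b′} {j} {p} {c} tree j≡ c<B unc old oldU oldV newU newV new = record
    { root        = λ x x<N → trans (old 0 x z≤n x<N) (root x x<N)
    ; child       = child′
    ; open-before = open-before′
    }
    where
    open Tree tree renaming (child to child-old)
    instance _ = nonZero-B 2≤Δ
    p≤ : ∀ p c → p ≤ p * B + c
    p≤ p c = ≤-trans (m≤m*n p B) (m≤m+n (p * B) c)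
    child′ : ∀ p c → c < B → p * B + c < suc j → ∀ x → x < N →
             mark′ (suc (p * B + c)) x ≡ (if does (x ≟ target (a′ p) (b′ p) c) then 1 else mark′ p x)
    child′ p₀ c₀ c₀<B (s≤s ≤j) x x<N with p₀ * B + c₀ ≟ j
    ... | no ≢j =
      trans (trans (old _ x <j x<N) (child-old p₀ c₀ c₀<B <j x x<N))
            (cong₂ (λ q y → if does (x ≟ q) then 1 else y)
                   (sym (cong₂ (λ u v → target u v c₀) (oldU p₀ p₀<j) (oldV p₀ p₀<j)))
                   (sym (old p₀ x (<⇒≤ p₀<j) x<N)))
      where
      <j = ≤∧≢⇒< ≤j ≢j
      p₀<j = ≤-<-trans (p≤ p₀ c₀) <j
    -- Only the node numbered `suc j` is new, and uniqueness of quotient and remainder identifies it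
    -- as child c of p.
    ... | yes ≡j with divMod-unique {p = p₀} {p} c₀<B c<B (trans ≡j j≡)
    ... | refl , refl = trans (cong (λ k → mark′ (suc k) x) ≡j)
      (trans (new x x<N) (cong (if does (x ≟ target (a′ p) (b′ p) c) then 1 else_)
        (sym (old p x (≤-trans (p≤ p c) ≤j) x<N))))
    open-before′ : ∀ i → i < suc j → Uncovered (mark′ i) (a′ i) (b′ i)
    open-before′ i (s≤s i≤j) with i ≟ j
    ... | yes refl = subst₂ (Uncovered (mark′ i)) (sym newU) (sym newV)
            (Uncovered-cong (λ x x<N → sym (old i x ≤-refl x<N)) unc)
    ... | no i≢j = let i<j = ≤∧≢⇒< i≤j i≢j in
      subst₂ (Uncovered (mark′ i)) (sym (oldU i i<j)) (sym (oldV i i<j))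
            (Uncovered-cong (λ x x<N → sym (old i x i≤j x<N)) (open-before i i<j))

  -- The memory while node j is current; child c of p is the next node.
  record Node (j : ℕ) (s : State) : Set where
    field
      {p c}       : ℕ
      input≡      : ∀ y → s input y ≡ A y
      stride≡     : s stride 0 ≡ W
      block≡      : s block 0 ≡ N
      node≡       : s node 0 ≡ j
      base≡       : s base 0 ≡ j * N
      parent≡     : s parent 0 ≡ p
      pbase≡      : s pbase 0 ≡ p * N
      child≡      : s child 0 ≡ c
      c<B         : c < B
      j≡          : j ≡ p * B + c
      mark        : ℕ → ℕ → ℕ
      startU      : ℕ → ℕ
      startV      : ℕ → ℕ
      marks≡      : ∀ i x → s marks (i * N + x) ≡ mark i x
      winU≡       : ∀ i → s winU i ≡ startU i
      winV≡       : ∀ i → s winV i ≡ startV i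
      tree        : Tree mark startU startV j

  -- As `mark`, `startU` and `startV` are fields of their own, the tree is carried over unchanged
  -- and only the equations that tie it to memory are renewed.
  Node-frame : ∀ {P j s s′} → keeps input P ≡ true → keeps stride P ≡ true → keeps block P ≡ true →
    keeps node P ≡ true → keeps base P ≡ true → keeps parent P ≡ true → keeps pbase P ≡ true →
    keeps child P ≡ true → keeps marks P ≡ true → keeps winU P ≡ true → keeps winV P ≡ true →
    Frame P s s′ → Node j s → Node j s′
  Node-frame k₁ k₂ k₃ k₄ k₅ k₆ k₇ k₈ k₉ k₁₀ k₁₁ fr nd = record
    { input≡  = λ y → trans (fr .at input k₁ y) (input≡ y)
    ; stride≡ = trans (fr .at stride k₂ 0) stride≡
    ; block≡  = trans (fr .at block k₃ 0) block≡
    ; node≡   = trans (fr .at node k₄ 0) node≡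
    ; base≡   = trans (fr .at base k₅ 0) base≡
    ; parent≡ = trans (fr .at parent k₆ 0) parent≡
    ; pbase≡  = trans (fr .at pbase k₇ 0) pbase≡
    ; child≡  = trans (fr .at child k₈ 0) child≡
    ; c<B     = c<B
    ; j≡      = j≡
    ; mark    = mark
    ; startU  = startU
    ; startV  = startV
    ; marks≡  = λ i x → trans (fr .at marks k₉ _) (marks≡ i x)
    ; winU≡   = λ i → trans (fr .at winU k₁₀ i) (winU≡ i)
    ; winV≡   = λ i → trans (fr .at winV k₁₁ i) (winV≡ i)
    ; tree    = tree
    }
    where open Node nd

  instance
    nonZero-N : NonZero N
    nonZero-N = m*n≢0 ν W

  -- The source block ends before `to`, so the second conjunct also guarantees, during the loop,
  -- that the cells still to be copied are intact.
  copyParent-run : ∀ {s from to} → s block 0 ≡ N → s base 0 ≡ to → s pbase 0 ≡ from → from + N ≤ to →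
    Run copyParent s (N * 1) λ s′ →
      (∀ x → x < N → s′ marks (to + x) ≡ s marks (from + x)) ×
      (∀ y → y < to → s′ marks y ≡ s marks y)
  copyParent-run {s} {from} {to} block≡ base≡ pbase≡ from+N≤to =
    for-run N Inv refl (λ s′ fr → trans (fr .at block refl 0) block≡) ((λ _ ()) , λ _ _ → refl) round
    where
    Inv : ℕ → State → Set
    Inv m s′ = (∀ x → x < m → s′ marks (to + x) ≡ s marks (from + x)) ×
               (∀ y → y < to → s′ marks y ≡ s marks y)
    round : ∀ m s′ → m < N → s′ idxX 0 ≡ m → Frame copyParent s s′ → Inv m s′ →
            Run (marks ⟨ var base ⊕ var idxX ⟩≔ marks ⟨ var pbase ⊕ var idxX ⟩) s′ 1
              (λ s″ → Inv (suc m) (store idxX 0 (suc m) s″))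
    round m s′ m<N refl fr (new , old) = set-run
      (below-suc (λ x x<m → trans (override-≢ λ eq → <⇒≢ x<m
                    (+-cancelˡ-≡ to x m (trans eq (cong (_+ m) base≡′)))) (new x x<m))
                 (trans (override-≡ (cong (_+ m) (sym base≡′)))
                   (trans (cong (λ f → s′ marks (f + m)) (trans (fr .at pbase refl 0) pbase≡))
                     (old (from + m) (<-≤-trans (+-monoʳ-< from m<N) from+N≤to)))) ,
       λ y y<to → trans (override-≢ λ eq → <⇒≱ y<to
         (≤-trans (m≤m+n to m) (≤-reflexive (sym (trans eq (cong (_+ m) base≡′)))))) (old y y<to))
      where
      base≡′ : s′ base 0 ≡ to
      base≡′ = trans (fr .at base refl 0) base≡

  module _ {Y} .{{_ : NonZero Y}} where

    markChild-run : ∀ {s to p c} → s input 0 ≡ Δ → s base 0 ≡ to → s parent 0 ≡ p → s child 0 ≡ c →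
      Run markChild s Y λ s′ → ∀ y →
        s′ marks y ≡ (if does (y ≟ to + target (s winU p) (s winV p) c) then 1 else s marks y)
    markChild-run {s} {c = c} Δ≡ refl refl refl = if-run
      (λ ≢0 → set-run λ y → cong (λ q → if does (y ≟ s base 0 + q) then 1 else s marks y)
        (sym (target-U _ _ (subst (c <_) Δ≡ (∸≢0⇒< ≢0)))))
      (λ ≡0 → set-run λ y → cong (λ q → if does (y ≟ s base 0 + q) then 1 else s marks y)
        (trans (cong (λ d → s winV (s parent 0) + (c ∸ d)) Δ≡)
          (sym (target-V _ _ (subst (_≤ c) Δ≡ (m∸n≡0⇒m≤n ≡0))))))

    nextChild-run : ∀ {s p c} → s input 0 ≡ Δ → s block 0 ≡ N → s parent 0 ≡ p → s pbase 0 ≡ p * N →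
      s child 0 ≡ c → c < B → Run nextChild s Y λ s′ → ∃[ p′ ] ∃[ c′ ]
        (s′ parent 0 ≡ p′ × s′ pbase 0 ≡ p′ * N × s′ child 0 ≡ c′ × c′ < B × suc (p * B + c) ≡ p′ * B + c′)
    nextChild-run {s} {p} {c} Δ≡ block≡ refl pbase≡ refl c<B = set-then (if-run
      (λ ≢0 → skip-run (p , suc c , refl , pbase≡ , refl , subst (suc c <_) B≡ (∸≢0⇒< ≢0)
                       , sym (+-suc (p * B) c)))
      (λ ≡0 → set-then (set-then (set-run
        ( suc p , 0 , refl , trans (cong₂ _+_ pbase≡ block≡) (+-comm (p * N) N) , refl
        , ≤-trans (s≤s z≤n) (2≤B 2≤Δ)
        , (begin
            suc (p * B + c)   ≡⟨ sym (+-suc (p * B) c) ⟩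
            p * B + suc c     ≡⟨ cong (p * B +_) (≤-antisym c<B (subst (_≤ suc c) B≡ (m∸n≡0⇒m≤n ≡0))) ⟩
            p * B + B         ≡⟨ +-comm (p * B) B ⟩
            suc p * B         ≡⟨ sym (+-identityʳ (suc p * B)) ⟩
            suc p * B + 0     ∎))))))
      where
      open ≡-Reasoning
      B≡ : s input 0 + s input 0 ≡ B
      B≡ = cong₂ _+_ Δ≡ (trans Δ≡ (sym (+-identityʳ Δ)))

  -- The cost unit of one node. The factor 2 lets it absorb the copying of n(T + 1) marks, which is
  -- at most 2nT because T ≥ 1.
  U : ℕ
  U = 2 * (ν * (ν * (T * 1)))

  instance
    nonZero-U : NonZero U
    nonZero-U = m*n≢0 2 (ν * (ν * (T * 1)))

  N≤U : N * 1 ≤ U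
  N≤U = begin
    ν * suc T * 1               ≡⟨ *-identityʳ (ν * suc T) ⟩
    ν * suc T                   ≤⟨ *-monoʳ-≤ ν (+-monoˡ-≤ T (>-nonZero⁻¹ T)) ⟩
    ν * (T + T)                 ≡⟨ cong (ν *_) (cong (T +_) (sym (+-identityʳ T))) ⟩
    ν * (2 * T)                 ≤⟨ m≤n*m (ν * (2 * T)) ν ⟩
    ν * (ν * (2 * T))           ≡⟨ identity ν T ⟩
    U                           ∎
    where
    open ≤-Reasoning
    identity : ∀ ν T → ν * (ν * (2 * T)) ≡ 2 * (ν * (ν * (T * 1)))
    identity = solve-∀

  module _ {j s} (nd : Node j s) (unc : Uncovered (Node.mark nd j) (s posU 0) (s posV 0)) where
    open Node nd

    private
      s₁ : State
      s₁ = store base 0 (s base 0 + s block 0) (store node 0 (suc (s node 0))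
             (store winV (s node 0) (s posV 0) (store winU (s node 0) (s posU 0) s)))

      base′≡ : s base 0 + s block 0 ≡ suc j * N
      base′≡ = trans (cong₂ _+_ base≡ block≡) (+-comm (j * N) N)

      p≤j : p ≤ j
      p≤j = ≤-trans (m≤m*n p B {{nonZero-B 2≤Δ}}) (≤-trans (m≤m+n (p * B) c) (≤-reflexive (sym j≡)))

      from+N≤to : p * N + N ≤ suc j * N
      from+N≤to = ≤-trans (≤-reflexive (+-comm (p * N) N)) (*-monoˡ-≤ N (s≤s p≤j))

      earlier : ∀ i x → i ≤ j → x < N → i * N + x < suc j * N
      earlier i x i≤j x<N = <-≤-trans (+-monoʳ-< (i * N) x<N)
        (≤-trans (≤-reflexive (+-comm (i * N) N)) (*-monoˡ-≤ N (s≤s i≤j)))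

      offset : ∀ x q {y z : ℕ} →
        (if does (suc j * N + x ≟ suc j * N + q) then y else z) ≡ (if does (x ≟ q) then y else z)
      offset x q with x ≟ q
      ... | yes refl = trans (override-≡ {suc j * N + x} refl) (sym (override-≡ {x} refl))
      ... | no x≢q = trans (override-≢ λ eq → x≢q (+-cancelˡ-≡ (suc j * N) x q eq)) (sym (override-≢ x≢q))

      module Steps {s₂ s₃ s₄} (fr₂ : Frame copyParent s₁ s₂) (fr₃ : Frame markChild s₂ s₃)
                   (fr₄ : Frame nextChild s₃ s₄) where

        kept : ∀ a → keeps a copyParent ≡ true → keeps a markChild ≡ true → keeps a nextChild ≡ true →
               ∀ i → s₄ a i ≡ s₁ a i
        kept a k₂ k₃ k₄ i = trans (fr₄ .at a k₄ i) (trans (fr₃ .at a k₃ i) (fr₂ .at a k₂ i))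

        marks-old : (∀ y → y < suc j * N → s₂ marks y ≡ s marks y) →
          (∀ y → s₃ marks y ≡ (if does (y ≟ suc j * N + target (s₂ winU p) (s₂ winV p) c) then 1 else s₂ marks y)) →
          ∀ i x → i ≤ j → x < N → s₄ marks (i * N + x) ≡ mark i x
        marks-old old marked i x i≤j x<N =
          trans (fr₄ .at marks refl _) (trans (marked _)
            (trans (override-≢ (<⇒≢ (<-≤-trans below (m≤m+n (suc j * N) _))))
              (trans (old _ below) (marks≡ i x))))
          where below = earlier i x i≤j x<N

        marks-new : (∀ x → x < N → s₂ marks (suc j * N + x) ≡ s marks (p * N + x)) →
          (∀ y → s₃ marks y ≡ (if does (y ≟ suc j * N + target (s₂ winU p) (s₂ winV p) c) then 1 else s₂ marks y)) →
          ∀ x → x < N → s₄ marks (suc j * N + x) ≡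
                        (if does (x ≟ target (s₄ winU p) (s₄ winV p) c) then 1 else mark p x)
        marks-new copied marked x x<N =
          trans (fr₄ .at marks refl _) (trans (marked _)
            (trans (offset x (target (s₂ winU p) (s₂ winV p) c))
              (cong₂ (λ q y → if does (x ≟ q) then 1 else y)
                (sym (cong₂ (λ u v → target u v c) (trans (fr₄ .at winU refl p) (fr₃ .at winU refl p))
                                                   (trans (fr₄ .at winV refl p) (fr₃ .at winV refl p))))
                (trans (copied x x<N) (marks≡ p x)))))

        assemble : (∀ x → x < N → s₂ marks (suc j * N + x) ≡ s marks (p * N + x)) →
          (∀ y → y < suc j * N → s₂ marks y ≡ s marks y) →
          (∀ y → s₃ marks y ≡ (if does (y ≟ suc j * N + target (s₂ winU p) (s₂ winV p) c) then 1 else s₂ marks y)) →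
          (∃[ p′ ] ∃[ c′ ] (s₄ parent 0 ≡ p′ × s₄ pbase 0 ≡ p′ * N × s₄ child 0 ≡ c′ × c′ < B ×
                            suc (p * B + c) ≡ p′ * B + c′)) →
          Node (suc j) s₄
        assemble copied old marked (p′ , c′ , parent′≡ , pbase′≡ , child′≡ , c′<B , sj≡) = record
          { input≡  = λ y → trans (kept input refl refl refl y) (input≡ y)
          ; stride≡ = trans (kept stride refl refl refl 0) stride≡
          ; block≡  = trans (kept block refl refl refl 0) block≡
          ; node≡   = trans (kept node refl refl refl 0) (cong suc node≡)
          ; base≡   = trans (kept base refl refl refl 0) base′≡
          ; parent≡ = parent′≡
          ; pbase≡  = pbase′≡
          ; child≡  = child′≡
          ; c<B     = c′<B
          ; j≡      = trans (cong suc j≡) sj≡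
          -- Read off the whole memory, so that `marks≡` holds even for x beyond the block; the
          -- restriction to `x < N` is left to the tree.
          ; mark    = λ i x → s₄ marks (i * N + x)
          ; startU  = s₄ winU
          ; startV  = s₄ winV
          ; marks≡  = λ _ _ → refl
          ; winU≡   = λ _ → refl
          ; winV≡   = λ _ → refl
          ; tree    = Tree-extend tree j≡ c<B unc (marks-old old marked)
              (λ i i<j → trans (kept winU refl refl refl i)
                 (trans (override-≢ (<⇒≢ (<-≤-trans i<j (≤-reflexive (sym node≡))))) (winU≡ i)))
              (λ i i<j → trans (kept winV refl refl refl i)
                 (trans (override-≢ (<⇒≢ (<-≤-trans i<j (≤-reflexive (sym node≡))))) (winV≡ i)))
              (trans (kept winU refl refl refl j) (override-≡ (sym node≡)))
              (trans (kept winV refl refl refl j) (override-≡ (sym node≡)))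
              (marks-new copied marked)
          }

    expand-run : Run expand s U (Node (suc j))
    expand-run = set-then (set-then (set-then (set-then (seq-run
      (enlarge N≤U (copyParent-run {s₁} block≡ base′≡ pbase≡ from+N≤to)) λ s₂ fr₂ (copied , old) → seq-run
      (markChild-run {s = s₂} (trans (fr₂ .at input refl 0) (input≡ 0)) (trans (fr₂ .at base refl 0) base′≡)
        (trans (fr₂ .at parent refl 0) parent≡) (trans (fr₂ .at child refl 0) child≡)) λ s₃ fr₃ marked →
      let kept = λ a (k₂ : keeps a copyParent ≡ true) (k₃ : keeps a markChild ≡ true) i →
            trans (fr₃ .at a k₃ i) (fr₂ .at a k₂ i) in
      map-run (λ s₄ fr₄ → Steps.assemble fr₂ fr₃ fr₄ copied old marked)
      (nextChild-run (trans (kept input refl refl 0) (input≡ 0)) (trans (kept block refl refl 0) block≡)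
        (trans (kept parent refl refl 0) parent≡) (trans (kept pbase refl refl 0) pbase≡)
        (trans (kept child refl refl 0) child≡) c<B)))))

  Scanned : ℕ → State → Set
  Scanned j s = Σ[ nd ∈ Node j s ]
    Status (Node.mark nd j) (s found 0) (s posU 0) (s posV 0) (Covered (Node.mark nd j))

  rescan : ∀ {j s} → Node j s → Run scan s U (Scanned j)
  rescan {j} {s} nd = enlarge (m≤m+n _ _) (map-run
    (λ s′ fr st → Node-frame refl refl refl refl refl refl refl refl refl refl refl fr nd , st)
    (scan-run record
      { input≡ = input≡ ; stride≡ = stride≡
      ; marks≡ = λ x → trans (cong (λ b → s marks (b + x)) base≡) (marks≡ j x) }))
    where open Node nd

  -- S serves termination alone and may be very large: the time is charged to j, which is compared
  -- with small covers only afterwards.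
  search-run : ∀ {s S} → Node 0 s → Hitting S →
    ∃[ j ] Run search s (suc j * U) λ s′ → s′ found 0 ≡ 0 × Scanned j s′
  search-run {s} {S} nd hitting = first-then-loop (rescan nd)
    where
    round : ∀ j s → Scanned j s → s found 0 ≢ 0 →
            j < suc (last (length S)) × Run (expand ⨾ scan) s U (Scanned (suc j))
    round j s (nd , inj₂ (≡0 , _)) ≢0 = contradiction ≡0 ≢0
    round j s (nd , inj₁ (_ , unc)) _ =
      s≤s (node-bound 2≤Δ (Node.tree nd) hitting) ,
      seq-run (expand-run nd unc) λ _ _ nd′ → rescan nd′

    first-then-loop : Run scan s U (Scanned 0) →
      ∃[ j ] Run search s (suc j * U) λ s′ → s′ found 0 ≡ 0 × Scanned j s′
    first-then-loop first =
      -- The unit depends on the number of rounds, so the loop is run from the final state of the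
      -- first scan before the sequence is assembled.
      Iterated.rounds loop , seq-run (enlarge U≤ (run {scan} (Run.exec first) (Run.bounded first) refl)) rest
      where
      loop : Iterated (var found) (expand ⨾ scan) (Run.final first) U Scanned
      loop = iterate Scanned (suc (last (length S))) round (Run.result first)
      U≤ : U ≤ suc (Iterated.rounds loop) * U
      U≤ = m≤m+n U _
      rest : ∀ s′ → Frame scan s s′ → s′ ≡ Run.final first →
        Run (while≢0 (var found) (expand ⨾ scan)) s′ (suc (Iterated.rounds loop) * U)
          λ s″ → s″ found 0 ≡ 0 × Scanned (Iterated.rounds loop) s″
      rest _ _ refl = map-run (λ _ _ (q , ≡0) → ≡0 , q) (until-run loop)

-- Output

-- The block length n(T + 1) comes from n additions of the stride, in place of a product.
setup emitNow emit : Program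
setup = stride ≔ lit 1 ⊕ [T] ⨾ for idxU [n] (block ≔ var block ⊕ var stride)
emitNow =
  output ⟨ lit 1 ⊕ var output ⟩≔ var idxU ⨾
  output ⟨ lit 2 ⊕ var output ⟩≔ now ⨾
  output ≔ lit 2 ⊕ var output
emit = rowU ≔ lit 0 ⨾
  for idxU [n]
    (for time [T] (if≢0 (markNow rowU) emitNow skip) ⨾
     rowU ≔ var rowU ⊕ var stride)

nth-++ˡ : ∀ xs ys {i} → i < length xs → nth (xs ++ ys) i ≡ nth xs i
nth-++ˡ (x ∷ xs) ys {zero}  _         = refl
nth-++ˡ (x ∷ xs) ys {suc i} (s≤s i<n) = nth-++ˡ xs ys i<n

nth-++ʳ : ∀ xs ys i → nth (xs ++ ys) (length xs + i) ≡ nth ys i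
nth-++ʳ []       ys i = refl
nth-++ʳ (x ∷ xs) ys i = nth-++ʳ xs ys i

-- `encodeAppearances` freed from the graph, of which only the number of vertices is available while
-- emitting.
encodePairs : ∀ {n} → List (Fin n × ℕ) → List ℕ
encodePairs = concatMap λ (v , t) → toℕ v ∷ t ∷ []

IsOutput-snoc : ∀ {s ys x y} → IsOutput s ys →
  IsOutput (store output 0 (2 + s output 0) (store output (2 + s output 0) y
             (store output (1 + s output 0) x s))) (ys ++ x ∷ y ∷ [])
IsOutput-snoc {s} {ys} {x} {y} (len , entries) =
  trans (cong (2 +_) len) (trans (+-comm 2 (length ys)) (sym (length-++ ys))) , entry
  where
  k = s output 0
  s′ = store output 0 (2 + k) (store output (2 + k) y (store output (1 + k) x s))
  zs = ys ++ x ∷ y ∷ []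
  entry : ∀ i → i < length zs → s′ output (suc i) ≡ nth zs i
  entry i i< with <-cmp i k
  ... | tri< i<k _ _ =
    trans (override-≢ {suc k} (<⇒≢ (m<n⇒m<1+n i<k))) (trans (override-≢ {k} (<⇒≢ i<k))
      (trans (entries i i<n) (sym (nth-++ˡ ys _ i<n))))
    where i<n = subst (i <_) len i<k
  ... | tri≈ _ refl _ =
    trans (override-≢ {suc k} (<⇒≢ (n<1+n k))) (trans (override-≡ {k} refl)
      (sym (trans (cong (nth zs) (trans len (sym (+-identityʳ (length ys))))) (nth-++ʳ ys _ 0))))
  ... | tri> _ _ k<i = trans (override-≡ {suc k} i≡)
      (sym (trans (cong (nth zs) (trans i≡ (trans (cong suc len) (+-comm 1 (length ys))))) (nth-++ʳ ys _ 1)))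
    where
    i≡ : i ≡ suc k
    i≡ = ≤-antisym (s≤s⁻¹ (≤-trans i< (≤-reflexive (trans (length-++ ys)
           (trans (+-comm (length ys) 2) (cong (2 +_) (sym len))))))) k<i

module Emit (A : ℕ → ℕ) .{{_ : NonZero (A 1)}} .{{_ : NonZero (A 2)}} where
  open Search A
  open Scan A

  -- Cells are met in increasing order; those below K have been treated.
  record Collected (M : ℕ → ℕ) (K : ℕ) (l : List (Fin ν × ℕ)) : Set where
    field
      unique   : Unique l
      sound    : ∀ {w t} → (w , t) ∈ l →
                 1 ≤ t × t ≤ T × M (cell (toℕ w) t) ≢ 0 × cell (toℕ w) t < K
      complete : ∀ w {t} → 1 ≤ t → t ≤ T → M (cell (toℕ w) t) ≢ 0 → cell (toℕ w) t < K → (w , t) ∈ l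
  open Collected

  Collected-skip : ∀ {M K l} → (∀ w {t} → 1 ≤ t → t ≤ T → cell (toℕ w) t ≡ K → M K ≡ 0) →
                   Collected M K l → Collected M (suc K) l
  Collected-skip {M} {K} none col .unique = col .unique
  Collected-skip {M} {K} none col .sound w∈ = let (a , b , c , <K) = col .sound w∈ in a , b , c , m<n⇒m<1+n <K
  Collected-skip {M} {K} none col .complete w {t} 1≤t t≤T ≢0 <1+K with cell (toℕ w) t ≟ K
  ... | yes ≡K = contradiction (trans (cong M ≡K) (none w 1≤t t≤T ≡K)) ≢0
  ... | no ≢K = col .complete w 1≤t t≤T ≢0 (≤∧≢⇒< (s≤s⁻¹ <1+K) ≢K)

  cell-injective : ∀ {w w′ : Fin ν} {t t′} → t ≤ T → t′ ≤ T → cell (toℕ w) t ≡ cell (toℕ w′) t′ →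
                   (w , t) ≡ (w′ , t′)
  cell-injective {w} {w′} t≤T t′≤T eq with divMod-unique {p = toℕ w} {toℕ w′} (s≤s t≤T) (s≤s t′≤T) eq
  ... | w≡ , refl with toℕ-injective w≡
  ... | refl = refl

  Collected-snoc : ∀ {M l u t} → 1 ≤ t → t ≤ T → M (cell (toℕ u) t) ≢ 0 →
                   Collected M (cell (toℕ u) t) l → Collected M (suc (cell (toℕ u) t)) (l ++ [ u , t ])
  Collected-snoc 1≤t t≤T ≢0 col .unique = Unique.++⁺ (col .unique) ([] ∷ []) λ where
    (w∈ , here refl) → let (_ , _ , _ , <K) = col .sound w∈ in <-irrefl refl <K
  Collected-snoc {l = l} 1≤t t≤T ≢0 col .sound w∈ with ∈-++⁻ l w∈
  ... | inj₁ w∈l = let (a , b , c , <K) = col .sound w∈l in a , b , c , m<n⇒m<1+n <K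
  ... | inj₂ (here refl) = 1≤t , t≤T , ≢0 , n<1+n _
  Collected-snoc {l = l} {u} {t} 1≤t t≤T _ col .complete w {t′} 1≤t′ t′≤T ≢0 <1+K
    with cell (toℕ w) t′ ≟ cell (toℕ u) t
  ... | yes ≡K = ∈-++⁺ʳ l (here (cell-injective t′≤T t≤T ≡K))
  ... | no ≢K = ∈-++⁺ˡ (col .complete w 1≤t′ t′≤T ≢0 (≤∧≢⇒< (s≤s⁻¹ <1+K) ≢K))

  Emitted : (ℕ → ℕ) → ℕ → State → Set
  Emitted M K s = ∃[ l ] (IsOutput s (encodePairs l) × Collected M K l)

  module _ {M : ℕ → ℕ} where

    cell-run : ∀ {u m s} → u < ν → m < T → Ready M s → s rowU 0 ≡ u * W → s idxU 0 ≡ u → s time 0 ≡ m →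
      Emitted M (u * W + suc m) s →
      Run (if≢0 (markNow rowU) emitNow skip) s 1 (Emitted M (u * W + suc (suc m)))
    cell-run {u} {m} {s} u<ν m<T h rowU≡ refl refl (l , out , col) = subst
      (λ K → Run (if≢0 (markNow rowU) emitNow skip) s 1 (Emitted M K)) (sym (+-suc (u * W) (suc m)))
      (if-run
        (λ ≢0 → set-then (set-then (set-run
          ( l ++ [ w , suc m ]
          , subst (IsOutput s′) (sym (concatMap-++ _ l [ w , suc m ]))
              (subst (λ x → IsOutput s′ (encodePairs l ++ x ∷ suc m ∷ [])) (sym w≡) (IsOutput-snoc {s} {encodePairs l} out))
          , subst (λ x → Collected M (suc (cell x (suc m))) (l ++ [ w , suc m ])) w≡
              (Collected-snoc (s≤s z≤n) m<T
                (λ ≡0 → ≢0 (trans marked≡ (trans (cong (λ x → M (cell x (suc m))) (sym w≡)) ≡0)))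
                (subst (λ x → Collected M (cell x (suc m)) l) (sym w≡) col))))))
        (λ ≡0 → skip-run (l , out , Collected-skip (λ _ _ _ _ → trans (sym marked≡) ≡0) col)))
      where
      open Ready h
      w = fromℕ< u<ν
      w≡ : toℕ w ≡ u
      w≡ = toℕ-fromℕ< u<ν
      k = s output 0
      s′ = store output 0 (2 + k) (store output (2 + k) (suc m) (store output (1 + k) u s))
      marked≡ : s marks (s base 0 + (s rowU 0 + suc m)) ≡ M (u * W + suc m)
      marked≡ = trans (marks≡ _) (cong (λ r → M (r + suc m)) rowU≡)

    emit-run : ∀ {s} → Ready M s → s output 0 ≡ 0 → Run emit s (ν * (T * 1)) (Emitted M (ν * W))
    emit-run {s} h out≡0 = set-then (map-run (λ _ _ → proj₂) (for-run ν RowInv′ refl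
      (λ s′ fr → trans (fr .at input refl 1) (H.input≡ 1))
      (refl , [] , (out≡0 , λ _ ()) , record
        { unique = [] ; sound = λ () ; complete = λ _ _ _ _ () })
      λ where
        u s′ u<ν refl fr (rowU≡ , l , out , col) → let h′ = Ready-frame refl refl refl refl fr (record { H }) in
          seq-run
            (for-run T (λ m s″ → Emitted M (s′ idxU 0 * W + suc m) s″) refl
              (λ s″ fr′ → trans (fr′ .at input refl 2) (Ready.input≡ h′ 2))
              -- The first cell of each row stands for time 0 and holds no appearance, so it counts
              -- as treated before the loop over time.
              (l , out , subst (λ K → Collected M K l) (sym (+-comm (u * W) 1))
                (Collected-skip (λ w 1≤t t≤T eq → contradiction
                  (sym (proj₂ (divMod-unique {p = toℕ w} {u} (s≤s t≤T) (s≤s z≤n)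
                    (trans eq (sym (+-identityʳ (u * W)))))))
                  (<⇒≢ 1≤t)) col))
              λ m s″ m<T eq fr′ → cell-run u<ν m<T (Ready-frame refl refl refl refl fr′ h′)
                (trans (fr′ .at rowU refl 0) rowU≡) (fr′ .at idxU refl 0) eq)
            λ s″ fr′ emitted → set-run
              ( trans (cong₂ _+_ (trans (fr′ .at rowU refl 0) rowU≡)
                                 (trans (fr′ .at stride refl 0) (Ready.stride≡ h′)))
                      (+-comm (u * W) W)
              , subst (λ K → Emitted M K s″) (+-comm (u * W) W) emitted)))
      where
      module H = Ready h
      RowInv′ : ℕ → State → Set
      RowInv′ u s = s rowU 0 ≡ u * W × Emitted M (u * W) s

-- Correctness and running time

-- Without labels there are no windows, and the untouched output array already encodes the empty
-- set.
coverProgram : Program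
coverProgram = if≢0 [T] (setup ⨾ search ⨾ emit) skip

-- The layout of the encoded graph

nth-blocks : ∀ {X : Set} {m len} (g : Fin m → X) (f : X → List ℕ) → (∀ x → length (f x) ≡ len) →
             ∀ u {i} → i < len → nth (concatMap f (tabulate g)) (toℕ u * len + i) ≡ nth (f (g u)) i
nth-blocks g f len zero {i} i< = nth-++ˡ (f (g zero)) _ (subst (i <_) (sym (len _)) i<)
nth-blocks {len = l} g f len (suc u) {i} i< =
  trans (cong (nth (concatMap f (tabulate g)))
          (trans (+-assoc l (toℕ u * l) i) (cong (_+ (toℕ u * l + i)) (sym (len (g zero))))))
    (trans (nth-++ʳ (f (g zero)) _ (toℕ u * l + i)) (nth-blocks (λ v → g (suc v)) f len u i<))

length-blocks : ∀ {X : Set} {m len} (g : Fin m → X) (f : X → List ℕ) → (∀ x → length (f x) ≡ len) →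
                length (concatMap f (tabulate g)) ≡ m * len
length-blocks {m = zero}  g f len = refl
length-blocks {m = suc m} g f len =
  trans (length-++ (f (g zero))) (cong₂ _+_ (len (g zero)) (length-blocks (λ v → g (suc v)) f len))

nth-map-applyUpTo : ∀ (f : ℕ → ℕ) (g : ℕ → ℕ) {k i} → i < k → nth (map f (applyUpTo g k)) i ≡ f (g i)
nth-map-applyUpTo f g {suc k} {zero}  _         = refl
nth-map-applyUpTo f g {suc k} {suc i} (s≤s i<k) = nth-map-applyUpTo f (λ j → g (suc j)) i<k

-- Without vertices there are no labels, and their maximum is the default 0.
nonempty-range : ∀ {n} (f : Fin n → List ℕ) → max 0 (concatMap f (allFin n)) ≢ 0 → NonZero n
nonempty-range {zero}  f ≢0 = contradiction refl ≢0
nonempty-range {suc n} f _  = _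

label≤lifetime : ∀ G u v {t} → t ∈ labels G u v → t ≤ lifetime G
label≤lifetime G u v t∈ = All.lookup (xs≤max 0 (concatMap (λ u → concatMap (labels G u) (allFin (n G))) (allFin (n G))))
  (∈-concatMap⁺ (λ u → concatMap (labels G u) (allFin (n G)))
    (lose (∈-allFin u) (∈-concatMap⁺ (labels G u) (lose (∈-allFin v) t∈))))

module _ (G : TemporalGraph) where

  private
    W : ℕ
    W = suc (lifetime G)

    pairBlock : Fin (n G) → Fin (n G) → List ℕ
    pairBlock u v = bit (adj G u v) ∷ map (λ t → bit (does (t ∈? labels G u v))) (applyUpTo suc (lifetime G))

    rowBlock : Fin (n G) → List ℕ
    rowBlock u = concatMap (pairBlock u) (allFin (n G))

    length-pairBlock : ∀ u v → length (pairBlock u v) ≡ W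
    length-pairBlock u v =
      cong suc (trans (length-map _ (applyUpTo suc (lifetime G))) (length-applyUpTo suc (lifetime G)))

    length-rowBlock : ∀ u → length (rowBlock u) ≡ n G * W
    length-rowBlock u = length-blocks (λ v → v) (pairBlock u) (length-pairBlock u)

  length-encodeTVC : ∀ Δ → length (encodeTVC Δ G) ≡ 3 + n G * (n G * suc (lifetime G))
  length-encodeTVC Δ = cong (3 +_) (length-blocks (λ u → u) rowBlock length-rowBlock)

  nth-encodeTVC : ∀ Δ u v {t} → t < lifetime G →
    nth (encodeTVC Δ G) (3 + ((toℕ u * n G + toℕ v) * suc (lifetime G) + suc t)) ≡
    bit (does (suc t ∈? labels G u v))
  nth-encodeTVC Δ u v {t} t<T =
    trans (cong (λ i → nth (encodeTVC Δ G) (3 + i)) (reindex (toℕ u) (n G) (toℕ v) W (suc t)))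
      (trans (nth-blocks (λ u → u) rowBlock length-rowBlock u inner<)
        (trans (nth-blocks (λ v → v) (pairBlock u) (length-pairBlock u) v (s≤s t<T))
          (nth-map-applyUpTo (λ t → bit (does (t ∈? labels G u v))) suc t<T)))
    where
    reindex : ∀ u n v W t → (u * n + v) * W + t ≡ u * (n * W) + (v * W + t)
    reindex = solve-∀
    inner< : toℕ v * W + suc t < n G * W
    inner< = Search.cell-bound (nth (encodeTVC Δ G)) (toℕ<n v) (s≤s t<T)

bit⇒ : ∀ {P : Set} (P? : Dec P) → bit (does P?) ≢ 0 → P
bit⇒ (yes p) _  = p
bit⇒ (no _)  ≢0 = contradiction refl ≢0

⇒bit : ∀ {P : Set} (P? : Dec P) → P → bit (does P?) ≢ 0
⇒bit (yes _) _ = λ ()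
⇒bit (no ¬p) p = contradiction p ¬p

Unique-map : ∀ {X Y : Set} {f : X → Y} {xs} → (∀ {x y} → x ∈ xs → y ∈ xs → f x ≡ f y → x ≡ y) →
             Unique xs → Unique (map f xs)
Unique-map inj []         = []
Unique-map inj (x∉ ∷ xs!) =
  All.map⁺ (All.tabulate λ y∈ eq → All.lookup x∉ y∈ (inj (here refl) (there y∈) eq)) ∷
  Unique-map (λ x∈ y∈ → inj (there x∈) (there y∈)) xs!

private
  -- One factor 2 of the 4 bounds the geometric sum of the levels, the other comes from the cost
  -- unit of a node.
  time-bound : ∀ K j B k T ν {t} → 2 + j ≤ 2 * B ^ k → t ≤ K * (suc j * (2 * (ν * (ν * (T * 1))))) →
               t ≤ 4 * K * (1 ⊔ (B ^ k * T * ν ^ 2))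
  time-bound K j B k T ν {t} 2+j≤ t≤ = begin
    t                                                   ≤⟨ t≤ ⟩
    K * (suc j * (2 * (ν * (ν * (T * 1)))))             ≤⟨ *-monoʳ-≤ K (*-monoˡ-≤ _ (≤-trans (n≤1+n (suc j)) 2+j≤)) ⟩
    K * (2 * B ^ k * (2 * (ν * (ν * (T * 1)))))         ≡⟨ identity K (B ^ k) T ν ⟩
    4 * K * (B ^ k * T * (ν * (ν * 1)))                 ≤⟨ *-monoʳ-≤ (4 * K) (m≤n⊔m 1 _) ⟩
    4 * K * (1 ⊔ (B ^ k * T * ν ^ 2))                   ∎
    where
    open ≤-Reasoning
    identity : ∀ K b T ν → K * (2 * b * (2 * (ν * (ν * (T * 1))))) ≡ 4 * K * (b * T * (ν * (ν * 1)))
    identity = solve-∀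

-- Covers of the graph and sets of cells

module Correct (Δ₀ : ℕ) (2≤Δ : 2 ≤ Δ₀) (G : TemporalGraph) (T≢0 : lifetime G ≢ 0) where

  A : ℕ → ℕ
  A = nth (encodeTVC Δ₀ G)

  instance
    nonZero-T : NonZero (lifetime G)
    nonZero-T = ≢-nonZero T≢0
    nonZero-n : NonZero (n G)
    nonZero-n = nonempty-range _ T≢0

  open Search A
  open Scan A
  open Main A 2≤Δ
  open Emit A

  module _ (u v : Fin (n G)) where

    Active⇒label : ∀ {t} → 1 ≤ t → t ≤ T → Active (toℕ u) (toℕ v) t → t ∈ labels G u v
    Active⇒label {suc t} _ t<T act =
      bit⇒ (suc t ∈? labels G u v) λ ≡0 → act (trans (nth-encodeTVC G Δ₀ u v t<T) ≡0)

    label⇒Active : ∀ {t} → 1 ≤ t → t ≤ T → t ∈ labels G u v → Active (toℕ u) (toℕ v) t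
    label⇒Active {suc t} _ t<T t∈ ≡0 =
      ⇒bit (suc t ∈? labels G u v) t∈ (trans (sym (nth-encodeTVC G Δ₀ u v t<T)) ≡0)

  InWindow⇒∈W : ∀ {i t} → InWindow i t → _∈W_ Δ₀ t i
  InWindow⇒∈W (i≤t , t<) = i≤t , ∸-monoˡ-≤ 1 t<

  ∈W⇒InWindow : ∀ {i t} → _∈W_ Δ₀ t i → InWindow i t
  -- Strictness needs `i + Δ₀` to be positive, since the subtraction of 1 is truncated.
  ∈W⇒InWindow {i} (i≤t , t≤) = i≤t , ≤-<-trans t≤ (pred< (i + Δ₀) (≤-trans (<⇒≤ 2≤Δ) (m≤n+m Δ₀ i)))
    where
    pred< : ∀ k → 1 ≤ k → k ∸ 1 < k
    pred< (suc k) _ = n<1+n k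

  appearance-cell : VertexAppearance G → ℕ
  appearance-cell (w , t) = cell (toℕ w) t

  TVC⇒Hitting : ∀ {S} → IsTVC Δ₀ G S → Hitting (map appearance-cell S)
  TVC⇒Hitting {S} tvc u u<ν v v<ν i 1≤i i+Δ≤W t t∈W act =
    subst₂ Hits (toℕ-fromℕ< u<ν) (toℕ-fromℕ< v<ν) (hit (IsTVC.covers tvc i
      (1≤i , ≤-trans i+Δ≤W (≤-reflexive (+-comm 1 T))) fu fv
      (labels-edge G fu fv t label , t , label , InWindow⇒∈W t∈W)))
    where
    fu = fromℕ< u<ν
    fv = fromℕ< v<ν
    Hits : ℕ → ℕ → Set
    Hits u v = ∃[ t ] (InWindow i t × Active u v t ×
                       (cell u t ∈ map appearance-cell S ⊎ cell v t ∈ map appearance-cell S))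
    1≤t : ∀ {t} → InWindow i t → 1 ≤ t
    1≤t (i≤t , _) = ≤-trans 1≤i i≤t
    t≤T : ∀ {t} → InWindow i t → t ≤ T
    t≤T t∈W = s≤s⁻¹ (InWindow⇒<W i+Δ≤W t∈W)
    label : t ∈ labels G fu fv
    label = Active⇒label fu fv (1≤t t∈W) (t≤T t∈W)
      (subst₂ (λ u v → Active u v t) (sym (toℕ-fromℕ< u<ν)) (sym (toℕ-fromℕ< v<ν)) act)
    hit : ∃[ w ] ∃[ t ] ((w , t) ∈ S × _∈W_ Δ₀ t i × (w ≡ fu ⊎ w ≡ fv) × t ∈ labels G fu fv) →
          Hits (toℕ fu) (toℕ fv)
    hit (w , t , w∈S , t∈W , end , t∈) = t , ∈W⇒InWindow t∈W ,
      label⇒Active fu fv (1≤t (∈W⇒InWindow t∈W)) (t≤T (∈W⇒InWindow t∈W)) t∈ , endpoint end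
      where
      endpoint : w ≡ fu ⊎ w ≡ fv →
                 cell (toℕ fu) t ∈ map appearance-cell S ⊎ cell (toℕ fv) t ∈ map appearance-cell S
      endpoint (inj₁ refl) = inj₁ (∈-map⁺ appearance-cell w∈S)
      endpoint (inj₂ refl) = inj₂ (∈-map⁺ appearance-cell w∈S)

  -- Provides a hitting set before any cover is known, which makes the search terminate.
  all-cells-hit : Hitting (upTo (ν * W))
  all-cells-hit u u<ν v v<ν i 1≤i i+Δ≤W t t∈W act =
    t , t∈W , act , inj₁ (∈-upTo⁺ (cell-bound u<ν (InWindow⇒<W i+Δ≤W t∈W)))

  module _ {M l} (collected : Collected M (ν * W) l) where
    open Collected collected

    covered⇒TVC : Covered M → IsTVC Δ₀ G l
    covered⇒TVC covered = record
      { unique = unique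
      ; valid  = All.tabulate λ w∈ → let (1≤t , t≤T , _) = sound w∈ in 1≤t , t≤T
      ; covers = covers
      }
      where
      covers : ∀ i → IsWindow Δ₀ G i → ∀ u v → InE[W] Δ₀ G i u v →
               ∃[ w ] ∃[ t ] ((w , t) ∈ l × _∈W_ Δ₀ t i × (w ≡ u ⊎ w ≡ v) × t ∈ labels G u v)
      covers i (1≤i , i+Δ≤) u v (_ , t , t∈ , t∈W)
        with covered (toℕ u) (toℕ<n u) (toℕ v) (toℕ<n v) i 1≤i (≤-trans i+Δ≤ (≤-reflexive (+-comm T 1)))
               t (∈W⇒InWindow t∈W) (label⇒Active u v (labels-pos G u v t t∈) (label≤lifetime G u v t∈) t∈)
      ... | t′ , t′∈W , act , hit = pick (M (cell (toℕ u) t′) ≟ 0)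
        where
        1≤t′ : 1 ≤ t′
        1≤t′ = ≤-trans 1≤i (proj₁ t′∈W)
        t′<W : t′ < W
        t′<W = InWindow⇒<W (≤-trans i+Δ≤ (≤-reflexive (+-comm T 1))) t′∈W
        Answer = ∃[ w ] ∃[ t ] ((w , t) ∈ l × _∈W_ Δ₀ t i × (w ≡ u ⊎ w ≡ v) × t ∈ labels G u v)
        answer : ∀ w → w ≡ u ⊎ w ≡ v → M (cell (toℕ w) t′) ≢ 0 → Answer
        answer w end ≢0 = w , t′ ,
          complete w 1≤t′ (s≤s⁻¹ t′<W) ≢0 (cell-bound (toℕ<n w) t′<W) ,
          InWindow⇒∈W t′∈W , end , Active⇒label u v 1≤t′ (s≤s⁻¹ t′<W) act
        pick : Dec (M (cell (toℕ u) t′) ≡ 0) → Answer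
        pick (no ≢0)  = answer u (inj₁ refl) ≢0
        pick (yes ≡0) = answer v (inj₂ refl) λ ≡0′ → hit (cong₂ _+_ ≡0 ≡0′)

    length-cells : ∀ {D} → (∀ x → x < ν * W → M x ≢ 0 → x ∈ D) → length l ≤ length D
    length-cells {D} marked∈D = subst (_≤ length D) (length-map appearance-cell l)
      (Unique-⊆⇒length≤ (Unique-map cells-distinct unique) cells⊆D)
      where
      cells⊆D : ∀ {x} → x ∈ map appearance-cell l → x ∈ D
      cells⊆D x∈ with ∈-map⁻ appearance-cell x∈
      ... | _ , w∈l , refl = let (_ , _ , ≢0 , <N) = sound w∈l in marked∈D _ <N ≢0
      cells-distinct : ∀ {x y} → x ∈ l → y ∈ l → appearance-cell x ≡ appearance-cell y → x ≡ y
      cells-distinct x∈ y∈ = cell-injective (proj₁ (proj₂ (sound x∈))) (proj₁ (proj₂ (sound y∈)))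

  setup-run : Run setup (initial (encodeTVC Δ₀ G)) U (Node 0)
  setup-run = set-then (enlarge ν≤U (map-run start
    (for-run ν (λ m s → s block 0 ≡ m * W) refl (λ s fr → fr .at input refl 1) refl
      λ m s _ _ fr eq → set-run (trans (cong₂ _+_ eq (fr .at stride refl 0)) (+-comm (m * W) W)))))
    where
    ν≤U : ν * 1 ≤ U
    ν≤U = ≤-trans (*-monoˡ-≤ 1 (m≤m*n ν W)) N≤U
    s₀ = store stride 0 W (initial (encodeTVC Δ₀ G))
    start : ∀ s → Frame (for idxU [n] (block ≔ var block ⊕ var stride)) s₀ s →
            s block 0 ≡ ν * W → Node 0 s
    start s fr block≡ = record
      { p       = 0
      ; c       = 0
      ; input≡  = fr .at input refl
      ; stride≡ = fr .at stride refl 0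
      ; block≡  = block≡
      ; node≡   = fr .at node refl 0
      ; base≡   = fr .at base refl 0
      ; parent≡ = fr .at parent refl 0
      ; pbase≡  = fr .at pbase refl 0
      ; child≡  = fr .at child refl 0
      ; c<B     = ≤-trans (s≤s z≤n) (2≤B 2≤Δ)
      ; j≡      = refl
      ; mark    = λ _ _ → 0
      ; startU  = λ _ → 0
      ; startV  = λ _ → 0
      ; marks≡  = λ i x → fr .at marks refl (i * (ν * W) + x)
      ; winU≡   = fr .at winU refl
      ; winV≡   = fr .at winV refl
      ; tree    = record { root = λ _ _ → refl ; child = λ _ _ _ () ; open-before = λ _ () }
      }

  -- Both bounds hold against every cover S: j lies on level `length S` at the latest, which limits
  -- the time, and a node there has at most `length S` marks, which makes l minimum.
  Final : ℕ → State → Set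
  Final j s = ∃[ l ] (IsOutput s (encodeAppearances G l) × IsTVC Δ₀ G l ×
    (∀ S → IsTVC Δ₀ G S → j ≤ last (length S) × length l ≤ length S))

  coverProgram-run : ∃[ j ] Run coverProgram (initial (encodeTVC Δ₀ G)) (suc j * U) (Final j)
  coverProgram-run = searched (search-run (Run.result setup-run) all-cells-hit)
    where
    s₁ : State
    s₁ = Run.final setup-run

    searched : ∃[ j ] Run search s₁ (suc j * U) (λ s → s found 0 ≡ 0 × Scanned j s) →
               ∃[ j ] Run coverProgram (initial (encodeTVC Δ₀ G)) (suc j * U) (Final j)
    searched (j , found-run) = j , if-run
      (λ _ → seq-run (enlarge U≤ (run {setup} (Run.exec setup-run) (Run.bounded setup-run) refl)) after-setup)
      (λ ≡0 → contradiction ≡0 T≢0)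
      where
      instance
        nonZero-total : NonZero (suc j * U)
        nonZero-total = m*n≢0 (suc j) U

      U≤ : U ≤ suc j * U
      U≤ = m≤m+n U (j * U)

      finish : ∀ {s s′} (nd : Node j s) → Covered (Node.mark nd j) → Emitted (Node.mark nd j) (ν * W) s′ → Final j s′
      finish nd covered (l , out , col) = l , out , covered⇒TVC col covered , optimal
        where
        optimal : ∀ S → IsTVC Δ₀ G S → j ≤ last (length S) × length l ≤ length S
        optimal S tvc = j≤ , bounded (few-marks 2≤Δ (Node.tree nd) (length S) j ≤-refl j≤)
          where
          j≤ : j ≤ last (length S)
          j≤ = subst (λ m → j ≤ last m) (length-map appearance-cell S)
                 (node-bound 2≤Δ (Node.tree nd) (TVC⇒Hitting tvc))
          bounded : ∃[ D ] (length D ≤ length S × (∀ x → x < ν * W → Node.mark nd j x ≢ 0 → x ∈ D)) →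
                    length l ≤ length S
          bounded (D , D≤ , marked∈D) = ≤-trans (length-cells col marked∈D) D≤

      after-search : ∀ s → s output 0 ≡ 0 → s found 0 ≡ 0 × Scanned j s → Run emit s (suc j * U) (Final j)
      after-search s out≡0 (≡0 , nd , inj₁ (≢0 , _)) = contradiction ≡0 ≢0
      after-search s out≡0 (_ , nd , inj₂ (_ , covered)) = enlarge
        (≤-trans (m≤n*m (ν * (T * 1)) ν) (≤-trans (m≤m+n (ν * (ν * (T * 1))) _) U≤))
        (map-run (λ s′ _ → finish {s} {s′} nd covered) (emit-run (record
          { input≡ = input≡ ; stride≡ = stride≡
          ; marks≡ = λ x → trans (cong (λ b → s marks (b + x)) base≡) (marks≡ j x) }) out≡0))
        where open Node nd

      after-setup : ∀ s → Frame setup (initial (encodeTVC Δ₀ G)) s → s ≡ s₁ →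
                    Run (search ⨾ emit) s (suc j * U) (Final j)
      after-setup s fr refl = seq-run found-run λ s₂ fr₂ found →
        after-search s₂ (trans (fr₂ .at output refl 0) (fr .at output refl 0)) found

-- The time bound

timeFactor : ℕ
timeFactor = 4 * coeff coverProgram

timeLimit : ℕ → TemporalGraph → ℕ → ℕ
timeLimit Δ G k = timeFactor * (1 ⊔ ((2 * Δ) ^ k * lifetime G * n G ^ 2))

Solved : ℕ → TemporalGraph → Set
Solved Δ G = ∃[ ys ] ∃[ t ] (Outputs coverProgram (encodeTVC Δ G) ys t × IsSolution (TVC Δ) G ys ×
                             (∀ k → IsParameter (TVC Δ) G k → t ≤ timeLimit Δ G k))

unlabelled-solved : ∀ {Δ} → 2 ≤ Δ → ∀ G → lifetime G ≡ 0 → Solved Δ G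
unlabelled-solved {Δ} 2≤Δ G T≡0 =
  -- The 4 steps are 1 for the branch, 2 for reading T and 1 for `skip`.
  [] , 4 , (_ , ⇓else T≡0 ⇓skip , refl , λ _ ()) , ([] , minimum , refl) , λ k _ → 4≤ k
  where
  4≤ : ∀ k → 4 ≤ timeLimit Δ G k
  4≤ k = *-mono-≤ {4} {timeFactor} {1} (m≤m*n 4 (coeff coverProgram)) (m≤m⊔n 1 ((2 * Δ) ^ k * lifetime G * n G ^ 2))
  minimum : IsMinimumTVC Δ G []
  minimum = record
    { isTVC   = record
      { unique = []
      ; valid  = []
      ; covers = λ i (1≤i , i+Δ≤) → contradiction
          (≤-trans (+-mono-≤ 1≤i 2≤Δ) (≤-trans i+Δ≤ (≤-reflexive (cong (_+ 1) T≡0)))) λ { (s≤s ()) }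
      }
    ; minimum = λ _ _ → z≤n
    }

labelled-solved : ∀ {Δ} → 2 ≤ Δ → ∀ G → lifetime G ≢ 0 → Solved Δ G
labelled-solved {Δ} 2≤Δ G T≢0 = solved coverProgram-run
  where
  open Correct Δ 2≤Δ G T≢0
  open Search A using (last; last-bound)
  solved : ∃[ j ] Run coverProgram (initial (encodeTVC Δ G)) (suc j * Main.U A 2≤Δ) (Final j) → Solved Δ G
  solved (j , run {time = t} D t≤ (l , out , tvc , optimal)) =
    encodeAppearances G l , t , (_ , D , out) ,
    (l , record { isTVC = tvc ; minimum = λ S tvc → proj₂ (optimal S tvc) } , refl) , in-time
    where
    in-time : ∀ k → IsParameter (TVC Δ) G k → t ≤ timeLimit Δ G k
    in-time k (S , min , refl) = time-bound (coeff coverProgram) j (2 * Δ) (length S) (lifetime G) (n G)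
      (≤-trans (+-monoʳ-≤ 2 (proj₁ (optimal S (IsMinimumTVC.isTVC min)))) (last-bound 2≤Δ (length S))) t≤

coverProgram-solves : ∀ Δ → 2 ≤ Δ → coverProgram Solves TVC Δ InTime timeLimit Δ
coverProgram-solves Δ 2≤Δ G = by-cases (lifetime G ≟ 0)
  where
  by-cases : Dec (lifetime G ≡ 0) → Solved Δ G
  by-cases (yes T≡0) = unlabelled-solved 2≤Δ G T≡0
  by-cases (no T≢0)  = labelled-solved 2≤Δ G T≢0

-- Fixed-parameter tractability

multiple : ℕ → Exp → Exp
multiple zero    e = lit 0
multiple (suc b) e = e ⊕ multiple b e

eval-multiple : ∀ b e s → eval (multiple b e) s ≡ b * eval e s
eval-multiple zero    e s = refl
eval-multiple (suc b) e s = cong (eval e s +_) (eval-multiple b e s)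

-- The factor b is a constant of this program, so multiplication by it unfolds into a sum. The
-- exponent is `suc k` because the loop rule asks for at least one round; the accumulator is the
-- output cell itself.
exponential-computable : ∀ c b → Computable (λ k → c * b ^ suc k)
exponential-computable c b = P , λ k → outputs (P-run k)
  where
  body P : Program
  body = output ⟨ lit 1 ⟩≔ multiple b (output ⟨ lit 1 ⟩)
  P = output ⟨ lit 1 ⟩≔ lit c ⨾ for idxX (lit 1 ⊕ var input) body ⨾ output ≔ lit 1

  P-run : ∀ k → Run P (initial (k ∷ [])) (suc k * 1) λ s → IsOutput s (c * b ^ suc k ∷ [])
  P-run k = set-then (seq-run
    (for-run (suc k) (λ m s → s output 1 ≡ c * b ^ m) refl
      (λ s fr → cong suc (fr .at input refl 0)) (sym (*-identityʳ c))
      λ m s _ _ _ eq → set-run (trans (eval-multiple b (output ⟨ lit 1 ⟩) s)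
        (trans (cong (b *_) eq) (swap b c (b ^ m)))))
    λ s _ eq → set-run (refl , λ { zero _ → eq ; (suc _) (s≤s ()) }))
    where
    instance _ = m*n≢0 (suc k) 1
    swap : ∀ b c x → b * (c * x) ≡ c * (b * x)
    swap = solve-∀

  outputs : ∀ {k} → Run P (initial (k ∷ [])) (suc k * 1) (λ s → IsOutput s (c * b ^ suc k ∷ [])) →
            ∃[ t ] Outputs P (k ∷ []) (c * b ^ suc k ∷ []) t
  outputs (run {time = t} D _ out) = t , _ , D , out

-- The size 3 + n²(T + 1) exceeds both n²T and 1, so the first power of the size is enough.
fpt-bound : ∀ Δ → 2 ≤ Δ → ∀ c G k → c * (1 ⊔ ((2 * Δ) ^ k * lifetime G * n G ^ 2)) ≤
            c * (2 * Δ) ^ suc k * length (encodeTVC Δ G) ^ 1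
fpt-bound Δ 2≤Δ c G k = begin
  c * (1 ⊔ (b ^ k * T * ν ^ 2))                 ≤⟨ *-monoʳ-≤ c (⊔-lub (*-mono-≤ 1≤b^ (s≤s z≤n)) (begin
    b ^ k * T * ν ^ 2                             ≡⟨ identity (b ^ k) T ν ⟩
    b ^ k * (ν * (ν * T))                         ≤⟨ *-mono-≤ (m≤n*m (b ^ k) b) (begin
      ν * (ν * T)                                   ≤⟨ *-monoʳ-≤ ν (*-monoʳ-≤ ν (n≤1+n T)) ⟩
      ν * (ν * suc T)                               ≤⟨ m≤n+m _ 3 ⟩
      3 + ν * (ν * suc T)                           ∎) ⟩
    b ^ suc k * (3 + ν * (ν * suc T))             ∎)) ⟩
  c * (b ^ suc k * (3 + ν * (ν * suc T)))       ≡⟨ sym (*-assoc c (b ^ suc k) _) ⟩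
  c * b ^ suc k * (3 + ν * (ν * suc T))         ≡⟨ cong (c * b ^ suc k *_)
                                                     (trans (sym (length-encodeTVC G Δ)) (sym (*-identityʳ _))) ⟩
  c * b ^ suc k * length (encodeTVC Δ G) ^ 1    ∎
  where
  open ≤-Reasoning
  b = 2 * Δ
  T = lifetime G
  ν = n G
  instance
    nonZero-b : NonZero b
    nonZero-b = >-nonZero (≤-trans (<⇒≤ 2≤Δ) (m≤m+n Δ _))
  1≤b^ : 1 ≤ b ^ suc k
  1≤b^ = >-nonZero⁻¹ (b ^ suc k) {{m^n≢0 b (suc k)}}
  identity : ∀ x T ν → x * T * (ν * (ν * 1)) ≡ x * (ν * (ν * T))
  identity = solve-∀

theorem4p4 : (∃[ P ] ∃[ C ] (∀ Δ → 2 ≤ Δ →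
    P Solves TVC Δ InTime λ G k → C * (1 ⊔ ((2 * Δ) ^ k * lifetime G * n G ^ 2))))
    × (∀ Δ → 2 ≤ Δ → FixedParameterTractable (TVC Δ))
theorem4p4 = (coverProgram , timeFactor , coverProgram-solves) , fpt
  where
  fpt : ∀ Δ → 2 ≤ Δ → FixedParameterTractable (TVC Δ)
  fpt Δ 2≤Δ = coverProgram , _ , 1 , exponential-computable timeFactor (2 * Δ) , λ G →
    let (ys , t , out , sol , t≤) = coverProgram-solves Δ 2≤Δ G in
    ys , t , out , sol , λ k param → ≤-trans (t≤ k param) (fpt-bound Δ 2≤Δ timeFactor G k)
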